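{- Let $p$ be a prime. Then \[ W_p \equiv -\overline{B}_1 \pmod{p}. \] For $p \geq 5$, we have \begin{align*} W_p &\equiv -2\overline{B}_1 + \overline{B}_2 - \tfrac{1}{2} p\, \overline{B}_1^2 \pmod{p^2},\\ W_p &\equiv -3\overline{B}_1 + 3\overline{B}_2 - \overline{B}_3 + p\left(-\tfrac{3}{2}\overline{B}_1^2 + \overline{B}_1\overline{B}_2\right) - p^2\left(\tfrac{1}{6}\overline{B}_1^3 + \tfrac{1}{3}\overline{B}_{1,2}\right) \pmod{p^3}. \end{align*} Equivalently, $(p-1)! \equiv -1 + p\,W_p \pmod{p^{r+1}}$ where, for $r=1$ (any prime $p$), $r=2$ and $r=3$ (primes $p\ge 5$), $W_p$ is replaced by the respective right-hand side above.
   Context: The Bernoulli numbers $B_n$ are defined by $\frac{t}{e^t-1}=\sum_{n\ge0}B_n\frac{t^n}{n!}$ (so $B_1=-\tfrac12$, $B_2=\tfrac16$). For a prime $p$, the Wilson quotient is $W_p = \frac{(p-1)!+1}{p}$. For $n\ge1$ define the divided Bernoulli numbers \[ \overline{B}_n = \frac{B_{n(p-1)} + \frac{1}{p} - 1}{n(p-1)}, \qquad \overline{B}_{n,2} = \frac{B_{n(p-1)-2}}{n(p-1)-2}, \] (for $p=2,3$ only $\overline{B}_1$ is used, defined by the same formula, giving $\overline{B}_1=-1$ for $p=2$ and $-\tfrac14$ for $p=3$). These are $p$-integral rationals; a congruence modulo $p^r$ between $p$-integral rationals means their difference lies in $p^r\mathbb{Z}_p$. -}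

module Defs where

open import Data.Nat as ℕ using (ℕ; zero; suc; _∸_; _^_; _!)
open import Data.Nat.Combinatorics using (_C_)
open import Data.Nat.Divisibility using (_∣_)
open import Data.Integer as ℤ using (ℤ; +_)
open import Data.Rational using (ℚ; _/_; _+_; _*_; _-_; -_; 0ℚ; 1ℚ; ↥_; ↧ₙ_)
open import Data.List using (List; []; _∷_; foldr; zipWith; upTo; _∷ʳ_; last)
open import Data.Maybe using (fromMaybe)
open import Data.Product using (_×_)
open import Relation.Nullary using (¬_)

-- The rational a/b (b a natural number).  Only ever used with b ≠ 0;
-- for b = 0 it returns 0 (a junk value that never occurs below).
frac : ℤ → ℕ → ℚ
frac a zero    = 0ℚ
frac a (suc b) = a / suc b

nℚ : ℕ → ℚ
nℚ n = frac (+ n) 1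

sumℚ : List ℚ → ℚ
sumℚ = foldr _+_ 0ℚ

-- List [B_0, B_1, ..., B_n] of Bernoulli numbers (convention B_1 = -1/2),
-- computed from the recurrence  Σ_{k=0}^{m} C(m+1,k) B_k = 0  (m ≥ 1),
-- B_0 = 1, which is equivalent to  t/(e^t - 1) = Σ B_n t^n / n!.
bernoulliList : ℕ → List ℚ
bernoulliList zero    = 1ℚ ∷ []
bernoulliList (suc n) = bs ∷ʳ next
  where
  bs : List ℚ
  bs = bernoulliList n
  next : ℚ
  next = - (frac (+ 1) (suc (suc n)) *
            sumℚ (zipWith (λ k b → nℚ (suc (suc n) C k) * b) (upTo (suc n)) bs))

B : ℕ → ℚ
B n = fromMaybe 0ℚ (last (bernoulliList n))

W : ℕ → ℚ
W p = frac (+ ((p ∸ 1) ! ℕ.+ 1)) p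

Bbar : ℕ → ℕ → ℚ
Bbar p n = (B (n ℕ.* (p ∸ 1)) + frac (+ 1) p - 1ℚ) * frac (+ 1) (n ℕ.* (p ∸ 1))

Bbar2 : ℕ → ℕ → ℚ
Bbar2 p n = B (n ℕ.* (p ∸ 1) ∸ 2) * frac (+ 1) (n ℕ.* (p ∸ 1) ∸ 2)

-- x ≡ y (mod p^r) for p-integral rationals: the difference x - y, written in
-- lowest terms a/b, has p^r ∣ a and p ∤ b (i.e. x - y ∈ p^r ℤ_p).
CongMod : ℕ → ℕ → ℚ → ℚ → Set
CongMod p r x y = (p ^ r ∣ ℤ.∣ ↥ (x - y) ∣) × ¬ (p ∣ ↧ₙ (x - y))

{-# OPTIONS --safe #-}
-- Write a^(p-1) = 1 + p q_a for 0 < a < p, S_j = Σ q_a^j and (p-1)! = -1 + p W.  Since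
-- ∏ (1 + p q_a) = (p-1)!^(p-1) = (1 - p W)^(p-1), taking logarithms gives, modulo p³,
--   S₁ - p S₂/2 + p² S₃/3 ≡ (p-1) (-W - p W²/2 - p² W³/3).
-- Expanding Σ a^(n(p-1)) = Σ (1 + p q_a)^n and comparing with Faulhaber's formula, where
-- p B_k is p-integral and odd Bernoulli numbers vanish, expresses (p-1) B̄_n modulo p³ as
--   S₁ + (n-1) p S₂/2 + (n-1)(n-2) p² S₃/6 - (n+1)(n+2) p² V/6,   V = Σ a^(p-3) q_a ≡ -B̄_{1,2},
-- the last term through Kummer's congruence Σ a^(p-3) ≡ 3 p V modulo p².  Extrapolating this
-- polynomial in n from n = 1, 2, 3 to n = 0 produces the logarithm on the left, and the
-- resulting equation is solved for W by iteration.  The primes 2, 3 and 5 are computed.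
module Submission where

open import Defs
open import Algebra.Properties.Group as GroupProperties using ()
open import Data.Integer as ℤ using (ℤ; +_)
import Data.Integer.Properties as ℤ
open import Data.List using (List; []; _∷_; _∷ʳ_; last; zipWith; applyUpTo; upTo)
open import Data.List.Properties using (applyUpTo-∷ʳ)
open import Data.Maybe using (just; fromMaybe)
open import Data.Nat as ℕ using (ℕ; zero; suc; _≥_; _!; s≤s; z≤n)
open import Data.Nat.Combinatorics using (_C_; nCk+nC[k+1]≡[n+1]C[k+1]; k>n⇒nCk≡0; nC1≡n; nCk≡nC[n∸k]; nCn≡1; nCk≡n!/k![n-k]!; k![n∸k]!∣n!)
open import Data.Nat.Coprimality as Coprimality using (Coprime)
open import Data.Nat.Divisibility as ℕ∣ using (_∣_; divides; _∣?_)
open import Data.Nat.DivMod using (m/n*n≡m)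
open import Data.Nat.Induction using (<-rec)
open import Data.Nat.Primality using (Prime; prime?; euclidsLemma; prime⇒nonZero; prime⇒nonTrivial; prime⇒irreducible)
import Data.Nat.Properties as ℕ
open import Data.Product using (_×_; _,_; ∃)
open import Data.Rational using (ℚ; mkℚ; _/_; _+_; _*_; _-_; -_; 0ℚ; 1ℚ; ↥_; ↧ₙ_; toℚᵘ)
open import Data.Rational.Properties as ℚ using (toℚᵘ-injective; toℚᵘ-fromℚᵘ; toℚᵘ-homo-+; toℚᵘ-homo-*)
open import Data.Rational.Unnormalised as ℚᵘ using (mkℚᵘ; *≡*)
import Data.Rational.Unnormalised.Properties as ℚᵘ
open import Data.Sum using (_⊎_; inj₁; inj₂; [_,_]′)
open import Function using (_∘_; _∋_; id)
open import Level using (0ℓ)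
open import Relation.Binary.PropositionalEquality
open import Relation.Nullary using (¬_; Dec; yes; no; ¬?; contradiction)
open import Relation.Nullary.Decidable using (dec⇒maybe; _×-dec_; from-yes; from-no)
open import Tactic.RingSolver using (solve-∀)
open import Tactic.RingSolver.Core.AlmostCommutativeRing using (AlmostCommutativeRing; fromCommutativeRing)

-- No logarithm is ever formed as a series. The product ∏ (1 + p q_a) is expanded in elementary
-- symmetric functions modulo p⁴, and the truncation of (e^(pL) - 1) / p is injective modulo p³, so
-- only polynomial identities over ℚ remain. One extra power of p is carried throughout, because
-- B̄_n and W both arise after a division by p.
--
-- The delicate point is the denominators in Faulhaber's formula: p^k / (k+1) has to lie in p⁴ for
-- every k ≥ 4. This holds for p ≥ 7 and fails for p = 5 at k = 4, which is why 5 joins the computed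
-- cases.
--
-- Kummer's congruence is needed in one instance only. For the exponent M = (p-3) p the power a^M
-- modulo p² depends only on a modulo p, so replacing a by 2a permutes the summands of Σ a^M. As 2^M
-- ≡ 1/4 modulo p differs from 1, that sum vanishes modulo p², and expanding it in Fermat quotients
-- relates Σ a^(p-3) to V.

ℚ-ring : AlmostCommutativeRing 0ℓ 0ℓ
ℚ-ring = fromCommutativeRing ℚ.+-*-commutativeRing (λ x → dec⇒maybe (0ℚ ℚ.≟ x))

-- Powers, integers and inverses in ℚ.

infixr 8 _^_
_^_ : ℚ → ℕ → ℚ
x ^ zero  = 1ℚ
x ^ suc n = x * x ^ n

^-+ : ∀ x k l → x ^ (k ℕ.+ l) ≡ x ^ k * x ^ l
^-+ x zero    l = sym (ℚ.*-identityˡ _)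
^-+ x (suc k) l = trans (cong (x *_) (^-+ x k l)) (sym (ℚ.*-assoc x (x ^ k) (x ^ l)))

ιℤ : ℤ → ℚ
ιℤ a = a / 1

-- The recursion makes `ι (suc n)` unfold to `1ℚ + ι n` for open `n`, which the ring solver can use;
-- `nℚ` is stuck there on the normalisation of a fraction.
ι : ℕ → ℚ
ι zero    = 0ℚ
ι (suc n) = 1ℚ + ι n

toℚᵘ-ιℤ : ∀ a → toℚᵘ (ιℤ a) ℚᵘ.≃ mkℚᵘ a 0
toℚᵘ-ιℤ a = toℚᵘ-fromℚᵘ (mkℚᵘ a 0)

ιℤ-+ : ∀ a b → ιℤ (a ℤ.+ b) ≡ ιℤ a + ιℤ b
ιℤ-+ a b = toℚᵘ-injective (begin
  toℚᵘ (ιℤ (a ℤ.+ b))             ≈⟨ toℚᵘ-ιℤ (a ℤ.+ b) ⟩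
  mkℚᵘ (a ℤ.+ b) 0                ≡⟨ cong (λ c → mkℚᵘ c 0) (sym (cong₂ ℤ._+_ (ℤ.*-identityʳ a) (ℤ.*-identityʳ b))) ⟩
  mkℚᵘ a 0 ℚᵘ.+ mkℚᵘ b 0          ≈⟨ ℚᵘ.+-cong (ℚᵘ.≃-sym (toℚᵘ-ιℤ a)) (ℚᵘ.≃-sym (toℚᵘ-ιℤ b)) ⟩
  toℚᵘ (ιℤ a) ℚᵘ.+ toℚᵘ (ιℤ b)    ≈⟨ ℚᵘ.≃-sym (toℚᵘ-homo-+ (ιℤ a) (ιℤ b)) ⟩
  toℚᵘ (ιℤ a + ιℤ b)              ∎)
  where open ℚᵘ.≃-Reasoning

ιℤ-* : ∀ a b → ιℤ (a ℤ.* b) ≡ ιℤ a * ιℤ b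
ιℤ-* a b = toℚᵘ-injective (begin
  toℚᵘ (ιℤ (a ℤ.* b))             ≈⟨ toℚᵘ-ιℤ (a ℤ.* b) ⟩
  mkℚᵘ a 0 ℚᵘ.* mkℚᵘ b 0          ≈⟨ ℚᵘ.*-cong (ℚᵘ.≃-sym (toℚᵘ-ιℤ a)) (ℚᵘ.≃-sym (toℚᵘ-ιℤ b)) ⟩
  toℚᵘ (ιℤ a) ℚᵘ.* toℚᵘ (ιℤ b)    ≈⟨ ℚᵘ.≃-sym (toℚᵘ-homo-* (ιℤ a) (ιℤ b)) ⟩
  toℚᵘ (ιℤ a * ιℤ b)              ∎)
  where open ℚᵘ.≃-Reasoning

ι≡ιℤ : ∀ n → ι n ≡ ιℤ (+ n)
ι≡ιℤ zero    = refl
ι≡ιℤ (suc n) = trans (cong (_+_ 1ℚ) (ι≡ιℤ n)) (sym (ιℤ-+ (+ 1) (+ n)))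

nℚ≡ι : ∀ n → nℚ n ≡ ι n
nℚ≡ι n = sym (ι≡ιℤ n)

ι-+ : ∀ m n → ι (m ℕ.+ n) ≡ ι m + ι n
ι-+ zero    n = sym (ℚ.+-identityˡ (ι n))
ι-+ (suc m) n = trans (cong (_+_ 1ℚ) (ι-+ m n)) (sym (ℚ.+-assoc 1ℚ (ι m) (ι n)))

ι-* : ∀ m n → ι (m ℕ.* n) ≡ ι m * ι n
ι-* zero    n = sym (ℚ.*-zeroˡ (ι n))
ι-* (suc m) n = trans (ι-+ n (m ℕ.* n)) (trans (cong (_+_ (ι n)) (ι-* m n))
  (((∀ x y → x + y * x ≡ (1ℚ + y) * x) ∋ solve-∀ ℚ-ring) (ι n) (ι m)))

ι-^ : ∀ m n → ι (m ℕ.^ n) ≡ ι m ^ n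
ι-^ m zero    = refl
ι-^ m (suc n) = trans (ι-* m (m ℕ.^ n)) (cong (ι m *_) (ι-^ m n))

ι*frac : ∀ a n → ι (suc n) * frac a (suc n) ≡ ιℤ a
ι*frac a n = trans (cong (_* frac a (suc n)) (ι≡ιℤ (suc n))) (toℚᵘ-injective (begin
  toℚᵘ (ιℤ (+ suc n) * (a / suc n))           ≈⟨ toℚᵘ-homo-* (ιℤ (+ suc n)) (a / suc n) ⟩
  toℚᵘ (ιℤ (+ suc n)) ℚᵘ.* toℚᵘ (a / suc n)   ≈⟨ ℚᵘ.*-cong (toℚᵘ-ιℤ (+ suc n)) (toℚᵘ-fromℚᵘ (mkℚᵘ a n)) ⟩
  mkℚᵘ (+ suc n) 0 ℚᵘ.* mkℚᵘ a n              ≈⟨ *≡* (trans (ℤ.*-identityʳ _) (trans (ℤ.*-comm (+ suc n) a) (cong (λ m → a ℤ.* + m) (sym (ℕ.+-identityʳ (suc n)))))) ⟩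
  mkℚᵘ a 0                                    ≈⟨ ℚᵘ.≃-sym (toℚᵘ-ιℤ a) ⟩
  toℚᵘ (ιℤ a)                                 ∎))
  where open ℚᵘ.≃-Reasoning

inv : ℕ → ℚ
inv n = frac (+ 1) n

ι*inv : ∀ n → ι (suc n) * inv (suc n) ≡ 1ℚ
ι*inv n = ι*frac (+ 1) n

ι*inv-nonZero : ∀ n .{{_ : ℕ.NonZero n}} → ι n * inv n ≡ 1ℚ
ι*inv-nonZero (suc n) = ι*inv n

inv-cancel : ∀ n x → inv (suc n) * (ι (suc n) * x) ≡ x
inv-cancel n x = trans (((∀ r y x → r * (y * x) ≡ (y * r) * x) ∋ solve-∀ ℚ-ring) (inv (suc n)) (ι (suc n)) x)
  (trans (cong (_* x) (ι*inv n)) (ℚ.*-identityˡ x))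

ι-cancel : ∀ n {x y} .{{_ : ℕ.NonZero n}} → ι n * x ≡ ι n * y → x ≡ y
ι-cancel (suc n) {x} {y} eq = trans (sym (inv-cancel n x)) (trans (cong (inv (suc n) *_) eq) (inv-cancel n y))

-- p-integral rationals and the powers of the ideal p ℤ_(p)
module Localisation (p : ℕ) (p-prime : Prime p) where

  instance
    p-nonZero : ℕ.NonZero p
    p-nonZero = prime⇒nonZero p-prime

  p∤1 : ¬ p ∣ 1
  p∤1 p∣1 = ℕ.nonTrivial⇒≢1 {{prime⇒nonTrivial p-prime}} (ℕ∣.∣1⇒≡1 p∣1)

  -- The fraction need not be reduced, so closure under sums and products is cross-multiplication;
  -- lowest terms return only in `∈p^⇒divides`.
  record Integral (x : ℚ) : Set where
    constructor integral
    field
      num     : ℤ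
      den     : ℕ
      p∤den   : ¬ p ∣ den
      x*den≡num : x * ι den ≡ ιℤ num

  p∤* : ∀ {m n} → ¬ p ∣ m → ¬ p ∣ n → ¬ p ∣ m ℕ.* n
  p∤* {m} {n} p∤m p∤n = [ p∤m , p∤n ]′ ∘ euclidsLemma m n p-prime

  integral-+ : ∀ {x y} → Integral x → Integral y → Integral (x + y)
  integral-+ {x} {y} (integral a b p∤b xb) (integral c d p∤d yd) =
    integral (a ℤ.* + d ℤ.+ c ℤ.* + b) (b ℕ.* d) (p∤* p∤b p∤d) (begin
      (x + y) * ι (b ℕ.* d)                        ≡⟨ cong ((x + y) *_) (ι-* b d) ⟩
      (x + y) * (ι b * ι d)                        ≡⟨ ((∀ x y b d → (x + y) * (b * d) ≡ (x * b) * d + (y * d) * b) ∋ solve-∀ ℚ-ring) x y (ι b) (ι d) ⟩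
      (x * ι b) * ι d + (y * ι d) * ι b            ≡⟨ cong₂ _+_ (cong₂ _*_ xb (ι≡ιℤ d)) (cong₂ _*_ yd (ι≡ιℤ b)) ⟩
      ιℤ a * ιℤ (+ d) + ιℤ c * ιℤ (+ b)            ≡⟨ cong₂ _+_ (ιℤ-* a (+ d)) (ιℤ-* c (+ b)) ⟨
      ιℤ (a ℤ.* + d) + ιℤ (c ℤ.* + b)              ≡⟨ ιℤ-+ (a ℤ.* + d) (c ℤ.* + b) ⟨
      ιℤ (a ℤ.* + d ℤ.+ c ℤ.* + b)                 ∎)
    where open ≡-Reasoning

  integral-* : ∀ {x y} → Integral x → Integral y → Integral (x * y)
  integral-* {x} {y} (integral a b p∤b xb) (integral c d p∤d yd) =
    integral (a ℤ.* c) (b ℕ.* d) (p∤* p∤b p∤d) (begin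
      (x * y) * ι (b ℕ.* d)                        ≡⟨ cong ((x * y) *_) (ι-* b d) ⟩
      (x * y) * (ι b * ι d)                        ≡⟨ ((∀ x y b d → (x * y) * (b * d) ≡ (x * b) * (y * d)) ∋ solve-∀ ℚ-ring) x y (ι b) (ι d) ⟩
      (x * ι b) * (y * ι d)                        ≡⟨ cong₂ _*_ xb yd ⟩
      ιℤ a * ιℤ c                                  ≡⟨ ιℤ-* a c ⟨
      ιℤ (a ℤ.* c)                                 ∎)
    where open ≡-Reasoning

  integral-ιℤ : ∀ a → Integral (ιℤ a)
  integral-ιℤ a = integral a 1 p∤1 (ℚ.*-identityʳ (ιℤ a))

  integral-ι : ∀ n → Integral (ι n)
  integral-ι n = subst Integral (sym (ι≡ιℤ n)) (integral-ιℤ (+ n))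

  integral-inv : ∀ {n} → ¬ p ∣ n → Integral (inv n)
  integral-inv {zero}  p∤0 = integral-ι 0
  integral-inv {suc n} p∤n = integral (+ 1) (suc n) p∤n (trans (ℚ.*-comm (inv (suc n)) (ι (suc n))) (ι*inv n))

  infix 4 _∈p^_
  record _∈p^_ (x : ℚ) (k : ℕ) : Set where
    constructor multiple
    field
      cofactor : ℚ
      x≡p^k*cofactor : x ≡ ι p ^ k * cofactor
      cofactor-integral : Integral cofactor

  +∈ : ∀ {k x y} → x ∈p^ k → y ∈p^ k → x + y ∈p^ k
  +∈ {k} (multiple a refl ia) (multiple b refl ib) =
    multiple (a + b) (sym (ℚ.*-distribˡ-+ (ι p ^ k) a b)) (integral-+ ia ib)

  *∈ : ∀ {k l x y} → x ∈p^ k → y ∈p^ l → x * y ∈p^ (k ℕ.+ l)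
  *∈ {k} {l} (multiple a refl ia) (multiple b refl ib) =
    multiple (a * b)
      (trans (((∀ u v a b → (u * a) * (v * b) ≡ (u * v) * (a * b)) ∋ solve-∀ ℚ-ring) (ι p ^ k) (ι p ^ l) a b)
             (cong (_* (a * b)) (sym (^-+ (ι p) k l))))
      (integral-* ia ib)

  0∈ : ∀ {x} → Integral x → x ∈p^ 0
  0∈ ix = multiple _ (sym (ℚ.*-identityˡ _)) ix

  ι∈ : ∀ n → ι n ∈p^ 0
  ι∈ n = 0∈ (integral-ι n)

  ιℤ∈ : ∀ n → ιℤ n ∈p^ 0
  ιℤ∈ n = 0∈ (integral-ιℤ n)

  infixr 7 _·∈_
  -- The integral factor stands on the left because `0 + k` reduces to `k`, whereas `k + 0` would
  -- need a transport.
  _·∈_ : ∀ {k x y} → x ∈p^ 0 → y ∈p^ k → x * y ∈p^ k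
  _·∈_ = *∈

  -∈ : ∀ {k x} → x ∈p^ k → - x ∈p^ k
  -∈ {k} {x} x∈ = subst (_∈p^ k) (((∀ x → ιℤ (ℤ.- (+ 1)) * x ≡ - x) ∋ solve-∀ ℚ-ring) x) (ιℤ∈ (ℤ.- (+ 1)) ·∈ x∈)

  p∈ : ι p ∈p^ 1
  p∈ = multiple 1ℚ (((∀ x → x ≡ (x * 1ℚ) * 1ℚ) ∋ solve-∀ ℚ-ring) (ι p)) (integral-ι 1)

  zero∈ : ∀ {k} → 0ℚ ∈p^ k
  zero∈ {k} = multiple 0ℚ (sym (ℚ.*-zeroʳ (ι p ^ k))) (integral-ι 0)

  weaken : ∀ {k l x} → k ℕ.≤ l → x ∈p^ l → x ∈p^ k
  weaken {k} {l} k≤l (multiple a refl ia) = multiple (ι p ^ (l ℕ.∸ k) * a)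
      (trans (cong (λ n → ι p ^ n * a) (sym (ℕ.m+[n∸m]≡n k≤l)))
        (trans (cong (_* a) (^-+ (ι p) k (l ℕ.∸ k))) (ℚ.*-assoc (ι p ^ k) (ι p ^ (l ℕ.∸ k)) a)))
      (integral-* (subst Integral (ι-^ p (l ℕ.∸ k)) (integral-ι (p ℕ.^ (l ℕ.∸ k)))) ia)

  p*∈ : ∀ {k x} → x ∈p^ k → ι p * x ∈p^ suc k
  p*∈ = *∈ p∈

  /p∈ : ∀ {k x} → ι p * x ∈p^ suc k → x ∈p^ k
  /p∈ {k} (multiple a eq ia) = multiple a (ι-cancel p (trans eq (ℚ.*-assoc (ι p) (ι p ^ k) a))) ia

  /unit∈ : ∀ {k x} n → ¬ p ∣ n → ι n * x ∈p^ k → x ∈p^ k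
  /unit∈ zero    p∤n _ = contradiction (p ℕ∣.∣0) p∤n
  /unit∈ {k} {x} (suc n) p∤n nx∈ = subst (_∈p^ k) (inv-cancel n x) (0∈ (integral-inv p∤n) ·∈ nx∈)

  infix 4 _≡_[p^_]
  _≡_[p^_] : ℚ → ℚ → ℕ → Set
  x ≡ y [p^ k ] = x - y ∈p^ k

  -- Comparing x = p^k a / b with its lowest terms gives |num| b = p^k |a| den. If p divided den it
  -- would divide num, as p ∤ b, against coprimality. The factor b is then cancelled from p^k ∣ num
  -- b, one p at a time.
  ∈p^⇒divides : ∀ {x k} → x ∈p^ k → p ℕ.^ k ∣ ℤ.∣ ↥ x ∣ × ¬ p ∣ ↧ₙ x
  ∈p^⇒divides {x} {k} (multiple y refl (integral a b p∤b yb)) = p^k∣num , p∤↧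
    where
    open ≡-Reasoning
    x*b : x * ιℤ (+ b) ≡ ιℤ (+ (p ℕ.^ k) ℤ.* a)
    x*b = begin
      (ι p ^ k * y) * ιℤ (+ b)      ≡⟨ cong ((ι p ^ k * y) *_) (ι≡ιℤ b) ⟨
      (ι p ^ k * y) * ι b           ≡⟨ ℚ.*-assoc (ι p ^ k) y (ι b) ⟩
      ι p ^ k * (y * ι b)           ≡⟨ cong₂ _*_ (trans (sym (ι-^ p k)) (ι≡ιℤ (p ℕ.^ k))) yb ⟩
      ιℤ (+ (p ℕ.^ k)) * ιℤ a       ≡⟨ ιℤ-* (+ (p ℕ.^ k)) a ⟨
      ιℤ (+ (p ℕ.^ k) ℤ.* a)        ∎
    toℚᵘx : toℚᵘ x ℚᵘ.* mkℚᵘ (+ b) 0 ℚᵘ.≃ mkℚᵘ (+ (p ℕ.^ k) ℤ.* a) 0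
    toℚᵘx = ℚᵘ.≃-trans (ℚᵘ.*-congˡ {toℚᵘ x} (ℚᵘ.≃-sym (toℚᵘ-ιℤ (+ b))))
           (ℚᵘ.≃-trans (ℚᵘ.≃-sym (toℚᵘ-homo-* x (ιℤ (+ b))))
           (ℚᵘ.≃-trans (ℚᵘ.≃-reflexive (cong toℚᵘ x*b)) (toℚᵘ-ιℤ _)))
    -- Stated for a variable `z` so that matching on `mkℚ` exposes numerator and denominator; `x`
    -- itself is already the product `ι p ^ k * y`.
    cross : ∀ z → toℚᵘ z ℚᵘ.* mkℚᵘ (+ b) 0 ℚᵘ.≃ mkℚᵘ (+ (p ℕ.^ k) ℤ.* a) 0 →
            ℤ.∣ ↥ z ∣ ℕ.* b ≡ p ℕ.^ k ℕ.* ℤ.∣ a ∣ ℕ.* ↧ₙ z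
    cross (mkℚ n d _) (*≡* eq) = begin
      ℤ.∣ n ∣ ℕ.* b                                  ≡⟨ ℤ.abs-* n (+ b) ⟨
      ℤ.∣ n ℤ.* + b ∣                                ≡⟨ cong ℤ.∣_∣ (ℤ.*-identityʳ (n ℤ.* + b)) ⟨
      ℤ.∣ n ℤ.* + b ℤ.* + 1 ∣                        ≡⟨ cong ℤ.∣_∣ eq ⟩
      ℤ.∣ + (p ℕ.^ k) ℤ.* a ℤ.* + (suc d ℕ.* 1) ∣     ≡⟨ ℤ.abs-* (+ (p ℕ.^ k) ℤ.* a) (+ (suc d ℕ.* 1)) ⟩
      ℤ.∣ + (p ℕ.^ k) ℤ.* a ∣ ℕ.* (suc d ℕ.* 1)       ≡⟨ cong₂ ℕ._*_ (ℤ.abs-* (+ (p ℕ.^ k)) a) (ℕ.*-identityʳ (suc d)) ⟩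
      p ℕ.^ k ℕ.* ℤ.∣ a ∣ ℕ.* suc d                  ∎
    crossed : ℤ.∣ ↥ x ∣ ℕ.* b ≡ p ℕ.^ k ℕ.* ℤ.∣ a ∣ ℕ.* ↧ₙ x
    crossed = cross x toℚᵘx
    reduced : ∀ z → Coprime ℤ.∣ ↥ z ∣ (↧ₙ z)
    reduced (mkℚ n d c) = Coprimality.recompute c
    p∤↧ : ¬ p ∣ ↧ₙ x
    p∤↧ p∣↧ with euclidsLemma ℤ.∣ ↥ x ∣ b p-prime (subst (p ∣_) (sym crossed) (ℕ∣.∣n⇒∣m*n (p ℕ.^ k ℕ.* ℤ.∣ a ∣) p∣↧))
    ... | inj₂ p∣b = p∤b p∣b
    ... | inj₁ p∣↥ = p∤1 (subst (p ∣_) (reduced x (p∣↥ , p∣↧)) ℕ∣.∣-refl)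
    p^k∣num : p ℕ.^ k ∣ ℤ.∣ ↥ x ∣
    p^k∣num = ∣-cancel-unit k (subst (p ℕ.^ k ∣_) (sym crossed)
        (ℕ∣.∣m⇒∣m*n (↧ₙ x) (ℕ∣.∣m⇒∣m*n ℤ.∣ a ∣ ℕ∣.∣-refl)))
      where
      ∣-cancel-unit : ∀ j {n} → p ℕ.^ j ∣ n ℕ.* b → p ℕ.^ j ∣ n
      ∣-cancel-unit zero    _ = ℕ∣.1∣ _
      ∣-cancel-unit (suc j) {n} p^∣ with euclidsLemma n b p-prime (ℕ∣.∣-trans (ℕ∣.∣m⇒∣m*n (p ℕ.^ j) ℕ∣.∣-refl) p^∣)
      ... | inj₂ p∣b = contradiction p∣b p∤b
      ... | inj₁ (divides q refl) = subst (p ℕ.^ suc j ∣_) (ℕ.*-comm p q) (ℕ∣.*-monoʳ-∣ p (∣-cancel-unit j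
              (ℕ∣.*-cancelˡ-∣ p (subst (p ℕ.^ suc j ∣_) (trans (cong (ℕ._* b) (ℕ.*-comm q p)) (ℕ.*-assoc p q b)) p^∣))))

  ∈p^⇒CongMod : ∀ {k} x y → x - y ∈p^ k → CongMod p k x y
  ∈p^⇒CongMod x y = ∈p^⇒divides

-- Exponential generating functions Σ f(n) tⁿ/n!, multiplied through the Leibniz rule.
Seq : Set
Seq = ℕ → ℚ

infixl 7 _⊛_
infixl 6 _⊕_

D : Seq → Seq
D f n = f (suc n)

_⊕_ : Seq → Seq → Seq
(f ⊕ g) n = f n + g n

_⊛_ : Seq → Seq → Seq
(f ⊛ g) zero    = f 0 * g 0
(f ⊛ g) (suc n) = (D f ⊛ g) n + (f ⊛ D g) n

-- `X` is the series t; below, `E a` is e^(at).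
𝟘 𝟙 X : Seq
𝟘 _       = 0ℚ
𝟙 zero    = 1ℚ
𝟙 (suc n) = 0ℚ
X zero    = 0ℚ
X (suc n) = 𝟙 n

E : ℚ → Seq
E a n = a ^ n

⊛-cong : ∀ {f f′ g g′ : Seq} → f ≗ f′ → g ≗ g′ → f ⊛ g ≗ f′ ⊛ g′
⊛-cong p q zero    = cong₂ _*_ (p 0) (q 0)
⊛-cong p q (suc n) = cong₂ _+_ (⊛-cong (p ∘ suc) q n) (⊛-cong p (q ∘ suc) n)

⊛-congˡ : ∀ {f g g′ : Seq} → g ≗ g′ → f ⊛ g ≗ f ⊛ g′
⊛-congˡ = ⊛-cong (λ _ → refl)

⊛-congʳ : ∀ {f f′ g : Seq} → f ≗ f′ → f ⊛ g ≗ f′ ⊛ g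
⊛-congʳ p = ⊛-cong p (λ _ → refl)

⊛-comm : ∀ f g → f ⊛ g ≗ g ⊛ f
⊛-comm f g zero    = ℚ.*-comm (f 0) (g 0)
⊛-comm f g (suc n) = trans (cong₂ _+_ (⊛-comm (D f) g n) (⊛-comm f (D g) n)) (ℚ.+-comm ((g ⊛ D f) n) ((D g ⊛ f) n))

+-interchange : ∀ a b c d → (a + b) + (c + d) ≡ (a + c) + (b + d)
+-interchange = solve-∀ ℚ-ring

⊛-distribʳ : ∀ f g h → (f ⊕ g) ⊛ h ≗ (f ⊛ h) ⊕ (g ⊛ h)
⊛-distribʳ f g h zero    = ℚ.*-distribʳ-+ (h 0) (f 0) (g 0)
⊛-distribʳ f g h (suc n) = trans (cong₂ _+_ (⊛-distribʳ (D f) (D g) h n) (⊛-distribʳ f g (D h) n))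
  (+-interchange ((D f ⊛ h) n) ((D g ⊛ h) n) ((f ⊛ D h) n) ((g ⊛ D h) n))

⊛-distribˡ : ∀ f g h → f ⊛ (g ⊕ h) ≗ (f ⊛ g) ⊕ (f ⊛ h)
⊛-distribˡ f g h n = trans (⊛-comm f (g ⊕ h) n) (trans (⊛-distribʳ g h f n) (cong₂ _+_ (⊛-comm g f n) (⊛-comm h f n)))

⊛-assoc : ∀ f g h → (f ⊛ g) ⊛ h ≗ f ⊛ (g ⊛ h)
⊛-assoc f g h zero    = ℚ.*-assoc (f 0) (g 0) (h 0)
⊛-assoc f g h (suc n) = begin
  ((D f ⊛ g ⊕ f ⊛ D g) ⊛ h) n + (f ⊛ g ⊛ D h) n                      ≡⟨ cong (_+ (f ⊛ g ⊛ D h) n) (⊛-distribʳ (D f ⊛ g) (f ⊛ D g) h n) ⟩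
  (D f ⊛ g ⊛ h) n + (f ⊛ D g ⊛ h) n + (f ⊛ g ⊛ D h) n                   ≡⟨ cong₂ _+_ (cong₂ _+_ (⊛-assoc (D f) g h n) (⊛-assoc f (D g) h n)) (⊛-assoc f g (D h) n) ⟩
  (D f ⊛ (g ⊛ h)) n + (f ⊛ (D g ⊛ h)) n + (f ⊛ (g ⊛ D h)) n             ≡⟨ ℚ.+-assoc ((D f ⊛ (g ⊛ h)) n) ((f ⊛ (D g ⊛ h)) n) ((f ⊛ (g ⊛ D h)) n) ⟩
  (D f ⊛ (g ⊛ h)) n + ((f ⊛ (D g ⊛ h)) n + (f ⊛ (g ⊛ D h)) n)           ≡⟨ cong (_+_ ((D f ⊛ (g ⊛ h)) n)) (⊛-distribˡ f (D g ⊛ h) (g ⊛ D h) n) ⟨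
  (D f ⊛ (g ⊛ h)) n + (f ⊛ D (g ⊛ h)) n                                 ∎
  where open ≡-Reasoning

⊛-scale : ∀ c f g n → ((λ k → c * f k) ⊛ g) n ≡ c * (f ⊛ g) n
⊛-scale c f g zero    = ℚ.*-assoc c (f 0) (g 0)
⊛-scale c f g (suc n) = trans (cong₂ _+_ (⊛-scale c (D f) g n) (⊛-scale c f (D g) n))
  (sym (ℚ.*-distribˡ-+ c ((D f ⊛ g) n) ((f ⊛ D g) n)))

⊛-scaleʳ : ∀ c f g n → (f ⊛ (λ k → c * g k)) n ≡ c * (f ⊛ g) n
⊛-scaleʳ c f g n = trans (⊛-comm f _ n) (trans (⊛-scale c g f n) (cong (c *_) (⊛-comm g f n)))

⊛-zeroˡ : ∀ f → 𝟘 ⊛ f ≗ 𝟘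
⊛-zeroˡ f zero    = ℚ.*-zeroˡ (f 0)
⊛-zeroˡ f (suc n) = cong₂ _+_ (⊛-zeroˡ f n) (⊛-zeroˡ (D f) n)

⊛-identityˡ : ∀ f → 𝟙 ⊛ f ≗ f
⊛-identityˡ f zero    = ℚ.*-identityˡ (f 0)
⊛-identityˡ f (suc n) = trans (cong₂ _+_ (⊛-zeroˡ f n) (⊛-identityˡ (D f) n)) (ℚ.+-identityˡ (f (suc n)))

⊛-identityʳ : ∀ f → f ⊛ 𝟙 ≗ f
⊛-identityʳ f n = trans (⊛-comm f 𝟙 n) (⊛-identityˡ f n)

X⊛-suc : ∀ f n → (X ⊛ f) (suc n) ≡ ι (suc n) * f n
X⊛-suc f zero    = trans (cong₂ _+_ (⊛-identityˡ f 0) (ℚ.*-zeroˡ (f 1)))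
  (((∀ x → x + 0ℚ ≡ (1ℚ + 0ℚ) * x) ∋ solve-∀ ℚ-ring) (f 0))
X⊛-suc f (suc n) = trans (cong₂ _+_ (⊛-identityˡ f (suc n)) (X⊛-suc (D f) n))
  (((∀ x y → x + y * x ≡ (1ℚ + y) * x) ∋ solve-∀ ℚ-ring) (f (suc n)) (ι (suc n)))

-- Coefficient n+1 of t f is (n+1) f n, and n+1 is invertible in ℚ.
X⊛-cancel : ∀ {f g} → X ⊛ f ≗ X ⊛ g → f ≗ g
X⊛-cancel {f} {g} eq n = ι-cancel (suc n) (trans (sym (X⊛-suc f n)) (trans (eq (suc n)) (X⊛-suc g n)))

X⊛-D : ∀ f n → (X ⊛ D f) n ≡ ι n * f n
X⊛-D f zero    = trans (ℚ.*-zeroˡ (f 1)) (sym (ℚ.*-zeroˡ (f 0)))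
X⊛-D f (suc n) = X⊛-suc (D f) n

E-⊛ : ∀ a b → E a ⊛ E b ≗ E (a + b)
E-⊛ a b zero    = refl
E-⊛ a b (suc n) = trans (cong₂ _+_ (trans (⊛-scale a (E a) (E b) n) (cong (a *_) (E-⊛ a b n)))
                                  (trans (⊛-scaleʳ b (E a) (E b) n) (cong (b *_) (E-⊛ a b n))))
  (sym (ℚ.*-distribʳ-+ (E (a + b) n) a b))

E-0 : E 0ℚ ≗ 𝟙
E-0 zero    = refl
E-0 (suc n) = ℚ.*-zeroˡ (0ℚ ^ n)

-- The series f(-t).
neg : Seq → Seq
neg f n = (- 1ℚ) ^ n * f n

neg-⊛ : ∀ f g → neg (f ⊛ g) ≗ neg f ⊛ neg g
neg-⊛ f g zero    = ((∀ x y → 1ℚ * (x * y) ≡ (1ℚ * x) * (1ℚ * y)) ∋ solve-∀ ℚ-ring) (f 0) (g 0)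
neg-⊛ f g (suc n) = begin
  ((- 1ℚ) * s) * ((D f ⊛ g) n + (f ⊛ D g) n)                    ≡⟨ ((∀ s x y → ((- 1ℚ) * s) * (x + y) ≡ (- 1ℚ) * (s * x) + (- 1ℚ) * (s * y)) ∋ solve-∀ ℚ-ring) s ((D f ⊛ g) n) ((f ⊛ D g) n) ⟩
  (- 1ℚ) * neg (D f ⊛ g) n + (- 1ℚ) * neg (f ⊛ D g) n           ≡⟨ cong₂ _+_ (cong ((- 1ℚ) *_) (neg-⊛ (D f) g n)) (cong ((- 1ℚ) *_) (neg-⊛ f (D g) n)) ⟩
  (- 1ℚ) * (neg (D f) ⊛ neg g) n + (- 1ℚ) * (neg f ⊛ neg (D g)) n ≡⟨ cong₂ _+_ (⊛-scale (- 1ℚ) (neg (D f)) (neg g) n) (⊛-scaleʳ (- 1ℚ) (neg f) (neg (D g)) n) ⟨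
  ((λ k → (- 1ℚ) * neg (D f) k) ⊛ neg g) n + (neg f ⊛ (λ k → (- 1ℚ) * neg (D g) k)) n ≡⟨ cong₂ _+_ (⊛-congʳ (D-neg f) n) (⊛-congˡ (D-neg g) n) ⟨
  (D (neg f) ⊛ neg g) n + (neg f ⊛ D (neg g)) n                 ∎
  where
  open ≡-Reasoning
  s = (- 1ℚ) ^ n
  D-neg : ∀ f k → D (neg f) k ≡ (- 1ℚ) * neg (D f) k
  D-neg f k = ℚ.*-assoc (- 1ℚ) ((- 1ℚ) ^ k) (f (suc k))

1^n : ∀ n → 1ℚ ^ n ≡ 1ℚ
1^n zero    = refl
1^n (suc n) = trans (ℚ.*-identityˡ (1ℚ ^ n)) (1^n n)

Σ< : ℕ → Seq → ℚ
Σ< zero    f = 0ℚ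
Σ< (suc n) f = f 0 + Σ< n (D f)

Σ<-last : ∀ n f → Σ< (suc n) f ≡ Σ< n f + f n
Σ<-last zero    f = ℚ.+-comm (f 0) 0ℚ
Σ<-last (suc n) f = trans (cong (_+_ (f 0)) (Σ<-last n (D f))) (sym (ℚ.+-assoc (f 0) (Σ< n (D f)) (f (suc n))))

Σ<-cong : ∀ n {f g : Seq} → f ≗ g → Σ< n f ≡ Σ< n g
Σ<-cong zero    p = refl
Σ<-cong (suc n) p = cong₂ _+_ (p 0) (Σ<-cong n (p ∘ suc))

Σ<-+ : ∀ n f g → Σ< n (f ⊕ g) ≡ Σ< n f + Σ< n g
Σ<-+ zero    f g = refl
Σ<-+ (suc n) f g = trans (cong (_+_ (f 0 + g 0)) (Σ<-+ n (D f) (D g))) (+-interchange (f 0) (g 0) (Σ< n (D f)) (Σ< n (D g)))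

Σ<-* : ∀ n c f → Σ< n (λ k → c * f k) ≡ c * Σ< n f
Σ<-* zero    c f = sym (ℚ.*-zeroʳ c)
Σ<-* (suc n) c f = trans (cong (_+_ (c * f 0)) (Σ<-* n c (D f))) (sym (ℚ.*-distribˡ-+ c (f 0) (Σ< n (D f))))

Σ<-const : ∀ n c → Σ< n (λ _ → c) ≡ ι n * c
Σ<-const zero    c = sym (ℚ.*-zeroˡ c)
Σ<-const (suc n) c = trans (cong (_+_ c) (Σ<-const n c)) (((∀ x c → c + x * c ≡ (1ℚ + x) * c) ∋ solve-∀ ℚ-ring) (ι n) c)

Σ<-- : ∀ n f g → Σ< n (λ k → f k - g k) ≡ Σ< n f - Σ< n g
Σ<-- zero    f g = refl
Σ<-- (suc n) f g = trans (cong (_+_ (f 0 - g 0)) (Σ<-- n (D f) (D g)))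
  (((∀ a b c d → (a - b) + (c - d) ≡ (a + c) - (b + d)) ∋ solve-∀ ℚ-ring) (f 0) (g 0) (Σ< n (D f)) (Σ< n (D g)))

-- As e^t is its own derivative, the Leibniz rule becomes Pascal's rule. This links the product with
-- the recurrence defining `B`, and later with the divisibility of C(p,k) by p.
⊛E1-binomial : ∀ f n → (f ⊛ E 1ℚ) n ≡ Σ< (suc n) (λ k → ι (n C k) * f k)
⊛E1-binomial f zero    = ((∀ x → x * 1ℚ ≡ (1ℚ + 0ℚ) * x + 0ℚ) ∋ solve-∀ ℚ-ring) (f 0)
⊛E1-binomial f (suc n) = begin
  (D f ⊛ E 1ℚ) n + (f ⊛ D (E 1ℚ)) n
    ≡⟨ cong₂ _+_ (⊛E1-binomial (D f) n) (trans (⊛-congˡ (λ k → ℚ.*-identityˡ (1ℚ ^ k)) n) (⊛E1-binomial f n)) ⟩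
  Σ< (suc n) (λ k → c n k * f (suc k)) + Σ< (suc n) (λ k → c n k * f k)
    ≡⟨ cong (_+_ (Σ< (suc n) (λ k → c n k * f (suc k)))) extend ⟩
  Σ< (suc n) (λ k → c n k * f (suc k)) + (c n 0 * f 0 + Σ< (suc n) (λ k → c n (suc k) * f (suc k)))
    ≡⟨ ((∀ x y z → x + (y + z) ≡ y + (x + z)) ∋ solve-∀ ℚ-ring) (Σ< (suc n) (λ k → c n k * f (suc k))) (c n 0 * f 0) (Σ< (suc n) (λ k → c n (suc k) * f (suc k))) ⟩
  c n 0 * f 0 + (Σ< (suc n) (λ k → c n k * f (suc k)) + Σ< (suc n) (λ k → c n (suc k) * f (suc k)))
    ≡⟨ cong (_+_ (c n 0 * f 0)) (Σ<-+ (suc n) (λ k → c n k * f (suc k)) (λ k → c n (suc k) * f (suc k))) ⟨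
  c n 0 * f 0 + Σ< (suc n) (λ k → c n k * f (suc k) + c n (suc k) * f (suc k))
    ≡⟨ cong₂ _+_ (cong (λ m → ι m * f 0) (trans (nC0≡1 n) (sym (nC0≡1 (suc n))))) (Σ<-cong (suc n) pascal) ⟩
  c (suc n) 0 * f 0 + Σ< (suc n) (λ k → c (suc n) (suc k) * f (suc k)) ∎
  where
  open ≡-Reasoning
  c : ℕ → ℕ → ℚ
  c n k = ι (n C k)
  nC0≡1 : ∀ n → n C 0 ≡ 1
  nC0≡1 n = trans (nCk≡nC[n∸k] {0} {n} ℕ.z≤n) (nCn≡1 n)
  extend : Σ< (suc n) (λ k → c n k * f k) ≡ c n 0 * f 0 + Σ< (suc n) (λ k → c n (suc k) * f (suc k))
  extend = sym (begin
    Σ< (suc (suc n)) (λ k → c n k * f k)                 ≡⟨ Σ<-last (suc n) (λ k → c n k * f k) ⟩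
    Σ< (suc n) (λ k → c n k * f k) + c n (suc n) * f (suc n) ≡⟨ cong (λ m → Σ< (suc n) (λ k → c n k * f k) + ι m * f (suc n)) (k>n⇒nCk≡0 (ℕ.n<1+n n)) ⟩
    Σ< (suc n) (λ k → c n k * f k) + 0ℚ * f (suc n)      ≡⟨ ((∀ x y → x + 0ℚ * y ≡ x) ∋ solve-∀ ℚ-ring) _ (f (suc n)) ⟩
    Σ< (suc n) (λ k → c n k * f k)                       ∎)
  pascal : ∀ k → c n k * f (suc k) + c n (suc k) * f (suc k) ≡ c (suc n) (suc k) * f (suc k)
  pascal k = trans (sym (ℚ.*-distribʳ-+ (f (suc k)) (c n k) (c n (suc k))))
    (cong (_* f (suc k)) (trans (sym (ι-+ (n C k) (n C suc k))) (cong ι (nCk+nC[k+1]≡[n+1]C[k+1] n k))))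

-- Bernoulli numbers: generating function and parity.

last-∷ʳ : ∀ {A : Set} (xs : List A) x → last (xs ∷ʳ x) ≡ just x
last-∷ʳ []           x = refl
last-∷ʳ (y ∷ [])     x = refl
last-∷ʳ (y ∷ z ∷ xs) x = last-∷ʳ (z ∷ xs) x

-- Each list extends its predecessor by one last entry, so the recurrence can be read in terms of
-- `B` alone.
bernoulliList≡applyUpTo : ∀ n → bernoulliList n ≡ applyUpTo B (suc n)
bernoulliList≡applyUpTo zero    = refl
bernoulliList≡applyUpTo (suc n) = trans (cong₂ _∷ʳ_ (bernoulliList≡applyUpTo n) (sym B-next)) (applyUpTo-∷ʳ B (suc n))
  where
  B-next : B (suc n) ≡ _
  B-next = cong (fromMaybe 0ℚ) (last-∷ʳ (bernoulliList n) _)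

zipWith-applyUpTo : ∀ (g : ℕ → ℚ → ℚ) u v n → zipWith g (applyUpTo u n) (applyUpTo v n) ≡ applyUpTo (λ k → g (u k) (v k)) n
zipWith-applyUpTo g u v zero    = refl
zipWith-applyUpTo g u v (suc n) = cong (g (u 0) (v 0) ∷_) (zipWith-applyUpTo g (u ∘ suc) (v ∘ suc) n)

sumℚ-applyUpTo : ∀ f n → sumℚ (applyUpTo f n) ≡ Σ< n f
sumℚ-applyUpTo f zero    = refl
sumℚ-applyUpTo f (suc n) = cong (_+_ (f 0)) (sumℚ-applyUpTo (D f) n)

B-suc : ∀ n → B (suc n) ≡ - (inv (suc (suc n)) * Σ< (suc n) (λ k → ι (suc (suc n) C k) * B k))
B-suc n = trans (cong (fromMaybe 0ℚ) (last-∷ʳ (bernoulliList n) _))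
  (cong (λ s → - (inv (suc (suc n)) * s)) (begin
    sumℚ (zipWith g (upTo (suc n)) (bernoulliList n))       ≡⟨ cong (λ bs → sumℚ (zipWith g (upTo (suc n)) bs)) (bernoulliList≡applyUpTo n) ⟩
    sumℚ (zipWith g (upTo (suc n)) (applyUpTo B (suc n)))   ≡⟨ cong sumℚ (zipWith-applyUpTo g id B (suc n)) ⟩
    sumℚ (applyUpTo (λ k → g k (B k)) (suc n))              ≡⟨ sumℚ-applyUpTo (λ k → g k (B k)) (suc n) ⟩
    Σ< (suc n) (λ k → g k (B k))                            ≡⟨ Σ<-cong (suc n) (λ k → cong (_* B k) (nℚ≡ι (suc (suc n) C k))) ⟩
    Σ< (suc n) (λ k → ι (suc (suc n) C k) * B k)            ∎))
  where
  open ≡-Reasoning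
  g : ℕ → ℚ → ℚ
  g k b = nℚ (suc (suc n) C k) * b

-- This is B(t) (e^t - 1) = t. In degree m ≥ 2 the last term of the binomial sum is `B m`, and the
-- recurrence says that all earlier terms cancel.
B⊛E1 : B ⊛ E 1ℚ ≗ B ⊕ X
B⊛E1 zero          = refl
B⊛E1 (suc zero)    = refl
B⊛E1 (suc (suc n)) = begin
  (B ⊛ E 1ℚ) (suc (suc n))                               ≡⟨ ⊛E1-binomial B (suc (suc n)) ⟩
  Σ< (suc (suc (suc n))) c                               ≡⟨ Σ<-last (suc (suc n)) c ⟩
  Σ< (suc (suc n)) c + c (suc (suc n))                   ≡⟨ cong₂ _+_ (Σ<-last (suc n) c) (cong (λ m → ι m * B (suc (suc n))) (nCn≡1 (suc (suc n)))) ⟩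
  (S + c (suc n)) + (1ℚ + 0ℚ) * B (suc (suc n))          ≡⟨ cong (λ x → (S + x) + (1ℚ + 0ℚ) * B (suc (suc n))) (cong₂ (λ m y → ι m * y) C≡ (B-suc n)) ⟩
  (S + ι m * - (inv m * S)) + (1ℚ + 0ℚ) * B (suc (suc n)) ≡⟨ ((∀ s m r b → (s + m * - (r * s)) + (1ℚ + 0ℚ) * b ≡ s - (m * r) * s + b) ∋ solve-∀ ℚ-ring) S (ι m) (inv m) (B (suc (suc n))) ⟩
  S - (ι m * inv m) * S + B (suc (suc n))                ≡⟨ cong (λ x → S - x * S + B (suc (suc n))) (ι*inv (suc n)) ⟩
  S - 1ℚ * S + B (suc (suc n))                           ≡⟨ ((∀ s b → s - 1ℚ * s + b ≡ b + 0ℚ) ∋ solve-∀ ℚ-ring) S (B (suc (suc n))) ⟩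
  B (suc (suc n)) + 0ℚ                                   ∎
  where
  open ≡-Reasoning
  m = suc (suc n)
  c : Seq
  c k = ι (m C k) * B k
  S = Σ< (suc n) c
  C≡ : m C suc n ≡ m
  C≡ = trans (nCk≡nC[n∸k] (ℕ.n≤1+n (suc n))) (trans (cong (m C_) (ℕ.m+n∸n≡m 1 n)) (nC1≡n m))

neg-E1 : neg (E 1ℚ) ≗ E (- 1ℚ)
neg-E1 n = trans (cong (((- 1ℚ) ^ n) *_) (1^n n)) (ℚ.*-identityʳ ((- 1ℚ) ^ n))

-- With d(t) = B(-t) - B(t) - t one gets d eᵗ = d, so that d B = d B eᵗ = d (B + t) and t d = 0.
neg-B : neg B ≗ B ⊕ X
neg-B n = begin
  neg B n                    ≡⟨ ((∀ x y → x ≡ (x + (- 1ℚ) * y) + y) ∋ solve-∀ ℚ-ring) (neg B n) ((B ⊕ X) n) ⟩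
  d n + (B ⊕ X) n            ≡⟨ cong (_+ (B ⊕ X) n) (d≗0 n) ⟩
  0ℚ + (B ⊕ X) n             ≡⟨ ℚ.+-identityˡ ((B ⊕ X) n) ⟩
  (B ⊕ X) n                  ∎
  where
  open ≡-Reasoning
  minus : Seq → Seq
  minus f k = (- 1ℚ) * f k
  d : Seq
  d = neg B ⊕ minus (B ⊕ X)
  neg-X : neg X ≗ minus X
  neg-X zero          = refl
  neg-X (suc zero)    = refl
  neg-X (suc (suc n)) = ℚ.*-zeroʳ ((- 1ℚ) ^ suc (suc n))
  B⁻⊛E1⁻ : neg B ⊛ E (- 1ℚ) ≗ neg B ⊕ minus X
  B⁻⊛E1⁻ n = begin
    (neg B ⊛ E (- 1ℚ)) n     ≡⟨ ⊛-congˡ neg-E1 n ⟨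
    (neg B ⊛ neg (E 1ℚ)) n   ≡⟨ neg-⊛ B (E 1ℚ) n ⟨
    neg (B ⊛ E 1ℚ) n         ≡⟨ cong (((- 1ℚ) ^ n) *_) (B⊛E1 n) ⟩
    neg (B ⊕ X) n            ≡⟨ ℚ.*-distribˡ-+ ((- 1ℚ) ^ n) (B n) (X n) ⟩
    neg B n + neg X n        ≡⟨ cong (_+_ (neg B n)) (neg-X n) ⟩
    neg B n + minus X n      ∎
  B⁻⊛E1 : ∀ n → neg B n ≡ (neg B ⊛ E 1ℚ) n + (- 1ℚ) * (X ⊛ E 1ℚ) n
  B⁻⊛E1 n = begin
    neg B n                                  ≡⟨ ⊛-identityʳ (neg B) n ⟨
    (neg B ⊛ 𝟙) n                            ≡⟨ ⊛-congˡ E-0 n ⟨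
    (neg B ⊛ E 0ℚ) n                         ≡⟨ ⊛-congˡ (E-⊛ (- 1ℚ) 1ℚ) n ⟨
    (neg B ⊛ (E (- 1ℚ) ⊛ E 1ℚ)) n            ≡⟨ ⊛-assoc (neg B) (E (- 1ℚ)) (E 1ℚ) n ⟨
    (neg B ⊛ E (- 1ℚ) ⊛ E 1ℚ) n              ≡⟨ ⊛-congʳ B⁻⊛E1⁻ n ⟩
    ((neg B ⊕ minus X) ⊛ E 1ℚ) n             ≡⟨ ⊛-distribʳ (neg B) (minus X) (E 1ℚ) n ⟩
    (neg B ⊛ E 1ℚ) n + (minus X ⊛ E 1ℚ) n    ≡⟨ cong (_+_ ((neg B ⊛ E 1ℚ) n)) (⊛-scale (- 1ℚ) X (E 1ℚ) n) ⟩
    (neg B ⊛ E 1ℚ) n + (- 1ℚ) * (X ⊛ E 1ℚ) n ∎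
  d⊛E1 : d ⊛ E 1ℚ ≗ d
  d⊛E1 n = begin
    (d ⊛ E 1ℚ) n                                                   ≡⟨ ⊛-distribʳ (neg B) (minus (B ⊕ X)) (E 1ℚ) n ⟩
    (neg B ⊛ E 1ℚ) n + (minus (B ⊕ X) ⊛ E 1ℚ) n                    ≡⟨ cong (_+_ ((neg B ⊛ E 1ℚ) n)) (⊛-scale (- 1ℚ) (B ⊕ X) (E 1ℚ) n) ⟩
    (neg B ⊛ E 1ℚ) n + (- 1ℚ) * ((B ⊕ X) ⊛ E 1ℚ) n                 ≡⟨ cong (λ x → (neg B ⊛ E 1ℚ) n + (- 1ℚ) * x) (trans (⊛-distribʳ B X (E 1ℚ) n) (cong (_+ (X ⊛ E 1ℚ) n) (B⊛E1 n))) ⟩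
    (neg B ⊛ E 1ℚ) n + (- 1ℚ) * ((B ⊕ X) n + (X ⊛ E 1ℚ) n)         ≡⟨ ((∀ u v w → u + (- 1ℚ) * (v + w) ≡ (u + (- 1ℚ) * w) + (- 1ℚ) * v) ∋ solve-∀ ℚ-ring) ((neg B ⊛ E 1ℚ) n) ((B ⊕ X) n) ((X ⊛ E 1ℚ) n) ⟩
    (neg B ⊛ E 1ℚ) n + (- 1ℚ) * (X ⊛ E 1ℚ) n + (- 1ℚ) * (B ⊕ X) n  ≡⟨ cong (_+ minus (B ⊕ X) n) (B⁻⊛E1 n) ⟨
    d n                                                            ∎
  d⊛X : ∀ n → (d ⊛ X) n ≡ 0ℚ
  d⊛X n = identityʳ-unique ((d ⊛ B) n) ((d ⊛ X) n) (begin
    (d ⊛ B) n + (d ⊛ X) n       ≡⟨ ⊛-distribˡ d B X n ⟨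
    (d ⊛ (B ⊕ X)) n             ≡⟨ ⊛-congˡ B⊛E1 n ⟨
    (d ⊛ (B ⊛ E 1ℚ)) n          ≡⟨ ⊛-congˡ (⊛-comm B (E 1ℚ)) n ⟩
    (d ⊛ (E 1ℚ ⊛ B)) n          ≡⟨ ⊛-assoc d (E 1ℚ) B n ⟨
    (d ⊛ E 1ℚ ⊛ B) n            ≡⟨ ⊛-congʳ d⊛E1 n ⟩
    (d ⊛ B) n                   ∎)
    where open GroupProperties ℚ.+-0-group using (identityʳ-unique)
  d≗0 : d ≗ 𝟘
  d≗0 = X⊛-cancel (λ n → trans (⊛-comm X d n) (trans (d⊛X n) (sym (trans (⊛-comm X 𝟘 n) (⊛-zeroˡ X n)))))

-- Even numbers in this form keep parity visible by computation: `3 + double h` is an odd index at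
-- least 3, `suc (double h)` an odd prime.
double : ℕ → ℕ
double zero    = zero
double (suc h) = suc (suc (double h))

^-double : ∀ x h → x ^ double h ≡ (x * x) ^ h
^-double x zero    = refl
^-double x (suc h) = trans (sym (ℚ.*-assoc x x (x ^ double h))) (cong (x * x *_) (^-double x h))

-- At odd degree at least 3 the identity B(-t) = B(t) + t reads -b = b + 0.
B-odd : ∀ h → B (3 ℕ.+ double h) ≡ 0ℚ
B-odd h = ι-cancel 2 (begin
  ι 2 * b                  ≡⟨ ((∀ x → ι 2 * x ≡ (x + 0ℚ) - (- 1ℚ * (- 1ℚ * (- 1ℚ * 1ℚ))) * x) ∋ solve-∀ ℚ-ring) b ⟩
  (b + 0ℚ) - (- 1ℚ * (- 1ℚ * (- 1ℚ * 1ℚ))) * b   ≡⟨ cong (λ s → (b + 0ℚ) - (- 1ℚ * (- 1ℚ * (- 1ℚ * s))) * b) (trans (^-double (- 1ℚ) h) (1^n h)) ⟨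
  (b + 0ℚ) - neg B (3 ℕ.+ double h)             ≡⟨ cong (λ x → (b + 0ℚ) - x) (neg-B (3 ℕ.+ double h)) ⟩
  (b + 0ℚ) - (b + 0ℚ)      ≡⟨ ℚ.+-inverseʳ (b + 0ℚ) ⟩
  ι 2 * 0ℚ                 ∎)
  where
  open ≡-Reasoning
  b = B (3 ℕ.+ double h)

-- Power sums and Faulhaber's formula.

-- Including a = 0, with 0⁰ = 1, makes the generating function in m the geometric sum 1 + e^t + ...
-- + e^((N-1)t).
powerSum : ℕ → Seq
powerSum N m = Σ< N (λ a → ι a ^ m)

-- The coefficients of (e^(xt) - 1) / (xt), the division by t producing the 1/(k+1).
faulhaberKernel : ℚ → Seq
faulhaberKernel x k = x ^ k * inv (suc k)

E-kernel : ∀ x → E x ≗ 𝟙 ⊕ (λ k → x * (X ⊛ faulhaberKernel x) k)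
E-kernel x zero    = ((∀ x y → 1ℚ ≡ 1ℚ + x * (0ℚ * y)) ∋ solve-∀ ℚ-ring) x (faulhaberKernel x 0)
E-kernel x (suc k) = sym (begin
  0ℚ + x * (X ⊛ faulhaberKernel x) (suc k)          ≡⟨ cong (λ z → 0ℚ + x * z) (X⊛-suc (faulhaberKernel x) k) ⟩
  0ℚ + x * (ι (suc k) * (x ^ k * inv (suc k)))      ≡⟨ ((∀ x i y r → 0ℚ + x * (i * (y * r)) ≡ x * ((i * r) * y)) ∋ solve-∀ ℚ-ring) x (ι (suc k)) (x ^ k) (inv (suc k)) ⟩
  x * ((ι (suc k) * inv (suc k)) * x ^ k)           ≡⟨ cong (λ z → x * (z * x ^ k)) (ι*inv k) ⟩
  x * (1ℚ * x ^ k)                                  ≡⟨ cong (x *_) (ℚ.*-identityˡ (x ^ k)) ⟩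
  x * x ^ k                                         ∎)
  where open ≡-Reasoning

-- Telescoping of B e^t = B + t: each further factor e^t contributes t e^(Nt).
B⊛E : ∀ N → B ⊛ E (ι N) ≗ B ⊕ X ⊛ powerSum N
B⊛E zero n = begin
  (B ⊛ E 0ℚ) n           ≡⟨ ⊛-congˡ E-0 n ⟩
  (B ⊛ 𝟙) n              ≡⟨ ⊛-identityʳ B n ⟩
  B n                    ≡⟨ ℚ.+-identityʳ (B n) ⟨
  B n + 0ℚ               ≡⟨ cong (_+_ (B n)) (trans (⊛-comm X 𝟘 n) (⊛-zeroˡ X n)) ⟨
  B n + (X ⊛ 𝟘) n        ∎
  where open ≡-Reasoning
B⊛E (suc N) n = begin
  (B ⊛ E (1ℚ + ι N)) n                                ≡⟨ ⊛-congˡ (E-⊛ 1ℚ (ι N)) n ⟨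
  (B ⊛ (E 1ℚ ⊛ E (ι N))) n                            ≡⟨ ⊛-assoc B (E 1ℚ) (E (ι N)) n ⟨
  (B ⊛ E 1ℚ ⊛ E (ι N)) n                              ≡⟨ ⊛-congʳ B⊛E1 n ⟩
  ((B ⊕ X) ⊛ E (ι N)) n                               ≡⟨ ⊛-distribʳ B X (E (ι N)) n ⟩
  (B ⊛ E (ι N)) n + (X ⊛ E (ι N)) n                   ≡⟨ cong (_+ (X ⊛ E (ι N)) n) (B⊛E N n) ⟩
  B n + (X ⊛ powerSum N) n + (X ⊛ E (ι N)) n          ≡⟨ ℚ.+-assoc (B n) ((X ⊛ powerSum N) n) ((X ⊛ E (ι N)) n) ⟩
  B n + ((X ⊛ powerSum N) n + (X ⊛ E (ι N)) n)        ≡⟨ cong (_+_ (B n)) (⊛-distribˡ X (powerSum N) (E (ι N)) n) ⟨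
  B n + (X ⊛ (powerSum N ⊕ E (ι N))) n                ≡⟨ cong (_+_ (B n)) (⊛-congˡ (λ m → Σ<-last N (λ a → ι a ^ m)) n) ⟨
  B n + (X ⊛ powerSum (suc N)) n                      ∎
  where open ≡-Reasoning

-- Inserting e^(Nt) = 1 + N t G in `B⊛E` and cancelling B and t leaves P = N B G. The factor N is
-- attached to B because p B_k is p-integral while B_k need not be.
faulhaber : ∀ N → powerSum N ≗ (λ k → ι N * B k) ⊛ faulhaberKernel (ι N)
faulhaber N n = trans (X⊛-cancel X⊛-eq n) (trans (⊛-scaleʳ (ι N) B G n) (sym (⊛-scale (ι N) B G n)))
  where
  open ≡-Reasoning
  open GroupProperties ℚ.+-0-group using (∙-cancelˡ)
  G = faulhaberKernel (ι N)
  X⊛-eq : X ⊛ powerSum N ≗ X ⊛ (B ⊛ (λ k → ι N * G k))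
  X⊛-eq n = ∙-cancelˡ (B n) _ _ (begin
    B n + (X ⊛ powerSum N) n                        ≡⟨ B⊛E N n ⟨
    (B ⊛ E (ι N)) n                                 ≡⟨ ⊛-congˡ (E-kernel (ι N)) n ⟩
    (B ⊛ (𝟙 ⊕ (λ k → ι N * (X ⊛ G) k))) n           ≡⟨ ⊛-distribˡ B 𝟙 (λ k → ι N * (X ⊛ G) k) n ⟩
    (B ⊛ 𝟙) n + (B ⊛ (λ k → ι N * (X ⊛ G) k)) n     ≡⟨ cong₂ _+_ (⊛-identityʳ B n) (⊛-congˡ (λ k → sym (⊛-scaleʳ (ι N) X G k)) n) ⟩
    B n + (B ⊛ (X ⊛ NG)) n                          ≡⟨ cong (_+_ (B n)) (⊛-assoc B X NG n) ⟨
    B n + (B ⊛ X ⊛ NG) n                            ≡⟨ cong (_+_ (B n)) (⊛-congʳ (⊛-comm B X) n) ⟩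
    B n + (X ⊛ B ⊛ NG) n                            ≡⟨ cong (_+_ (B n)) (⊛-assoc X B NG n) ⟩
    B n + (X ⊛ (B ⊛ NG)) n                          ∎)
    where
    NG : Seq
    NG k = ι N * G k

scaled : ℚ → Seq → Seq
scaled c f k = c * f k

-- Degrees below j are zeroed, not shifted away: for the Faulhaber kernel at p this is the part
-- divisible by p^j, for j at most 4.
drop : ℕ → Seq → Seq
drop zero    f k       = f k
drop (suc j) f zero    = 0ℚ
drop (suc j) f (suc k) = drop j (D f) k

⊛-drop₁ : ∀ f g n → (f ⊛ g) n ≡ g 0 * f n + (f ⊛ drop 1 g) n
⊛-drop₁ f g n = begin
  (f ⊛ g) n                                     ≡⟨ ⊛-congˡ g≗ n ⟩
  (f ⊛ (scaled (g 0) 𝟙 ⊕ drop 1 g)) n           ≡⟨ ⊛-distribˡ f (scaled (g 0) 𝟙) (drop 1 g) n ⟩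
  (f ⊛ scaled (g 0) 𝟙) n + (f ⊛ drop 1 g) n     ≡⟨ cong (_+ (f ⊛ drop 1 g) n) (⊛-scaleʳ (g 0) f 𝟙 n) ⟩
  g 0 * (f ⊛ 𝟙) n + (f ⊛ drop 1 g) n            ≡⟨ cong (λ x → g 0 * x + (f ⊛ drop 1 g) n) (⊛-identityʳ f n) ⟩
  g 0 * f n + (f ⊛ drop 1 g) n                  ∎
  where
  open ≡-Reasoning
  g≗ : g ≗ scaled (g 0) 𝟙 ⊕ drop 1 g
  g≗ zero    = ((∀ x → x ≡ x * 1ℚ + 0ℚ) ∋ solve-∀ ℚ-ring) (g 0)
  g≗ (suc k) = ((∀ x y → y ≡ x * 0ℚ + y) ∋ solve-∀ ℚ-ring) (g 0) (g (suc k))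

⊛-drop₂ : ∀ f g n → (f ⊛ g) (suc n) ≡ g 0 * f (suc n) + g 1 * (ι (suc n) * f n) + (f ⊛ drop 2 g) (suc n)
⊛-drop₂ f g n = begin
  (f ⊛ g) (suc n)                                                 ≡⟨ ⊛-drop₁ f g (suc n) ⟩
  g 0 * f (suc n) + (f ⊛ drop 1 g) (suc n)                        ≡⟨ cong (_+_ (g 0 * f (suc n))) (⊛-congˡ g≗ (suc n)) ⟩
  g 0 * f (suc n) + (f ⊛ (scaled (g 1) X ⊕ drop 2 g)) (suc n)     ≡⟨ cong (_+_ (g 0 * f (suc n))) (⊛-distribˡ f (scaled (g 1) X) (drop 2 g) (suc n)) ⟩
  g 0 * f (suc n) + ((f ⊛ scaled (g 1) X) (suc n) + (f ⊛ drop 2 g) (suc n)) ≡⟨ ℚ.+-assoc (g 0 * f (suc n)) ((f ⊛ scaled (g 1) X) (suc n)) ((f ⊛ drop 2 g) (suc n)) ⟨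
  g 0 * f (suc n) + (f ⊛ scaled (g 1) X) (suc n) + (f ⊛ drop 2 g) (suc n) ≡⟨ cong (λ x → g 0 * f (suc n) + x + (f ⊛ drop 2 g) (suc n)) (trans (⊛-scaleʳ (g 1) f X (suc n)) (cong (g 1 *_) (trans (⊛-comm f X (suc n)) (X⊛-suc f n)))) ⟩
  g 0 * f (suc n) + g 1 * (ι (suc n) * f n) + (f ⊛ drop 2 g) (suc n) ∎
  where
  open ≡-Reasoning
  g≗ : drop 1 g ≗ scaled (g 1) X ⊕ drop 2 g
  g≗ zero          = ((∀ x → 0ℚ ≡ x * 0ℚ + 0ℚ) ∋ solve-∀ ℚ-ring) (g 1)
  g≗ (suc zero)    = ((∀ x → x ≡ x * 1ℚ + 0ℚ) ∋ solve-∀ ℚ-ring) (g 1)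
  g≗ (suc (suc k)) = ((∀ x y → y ≡ x * 0ℚ + y) ∋ solve-∀ ℚ-ring) (g 1) (g (suc (suc k)))

X² X³ : Seq
X² = X ⊛ X
X³ = X ⊛ X²

X²-vanish : ∀ k → X² (3 ℕ.+ k) ≡ 0ℚ
X²-vanish k = trans (X⊛-suc X (2 ℕ.+ k)) (ℚ.*-zeroʳ (ι (3 ℕ.+ k)))

⊛-X² : ∀ f n → (f ⊛ X²) (2 ℕ.+ n) ≡ ι (2 ℕ.+ n) * (ι (1 ℕ.+ n) * f n)
⊛-X² f n = begin
  (f ⊛ X²) (2 ℕ.+ n)                         ≡⟨ ⊛-comm f X² (2 ℕ.+ n) ⟩
  (X ⊛ X ⊛ f) (2 ℕ.+ n)                      ≡⟨ ⊛-assoc X X f (2 ℕ.+ n) ⟩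
  (X ⊛ (X ⊛ f)) (2 ℕ.+ n)                    ≡⟨ X⊛-suc (X ⊛ f) (suc n) ⟩
  ι (2 ℕ.+ n) * (X ⊛ f) (suc n)              ≡⟨ cong (ι (2 ℕ.+ n) *_) (X⊛-suc f n) ⟩
  ι (2 ℕ.+ n) * (ι (1 ℕ.+ n) * f n)          ∎
  where open ≡-Reasoning

⊛-X³ : ∀ f n → (f ⊛ X³) (3 ℕ.+ n) ≡ ι (3 ℕ.+ n) * (ι (2 ℕ.+ n) * (ι (1 ℕ.+ n) * f n))
⊛-X³ f n = begin
  (f ⊛ X³) (3 ℕ.+ n)                         ≡⟨ ⊛-assoc f X X² (3 ℕ.+ n) ⟨
  (f ⊛ X ⊛ X²) (3 ℕ.+ n)                     ≡⟨ ⊛-congʳ (⊛-comm f X) (3 ℕ.+ n) ⟩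
  (X ⊛ f ⊛ X²) (3 ℕ.+ n)                     ≡⟨ ⊛-assoc X f X² (3 ℕ.+ n) ⟩
  (X ⊛ (f ⊛ X²)) (3 ℕ.+ n)                   ≡⟨ X⊛-suc (f ⊛ X²) (2 ℕ.+ n) ⟩
  ι (3 ℕ.+ n) * (f ⊛ X²) (2 ℕ.+ n)           ≡⟨ cong (ι (3 ℕ.+ n) *_) (⊛-X² f n) ⟩
  ι (3 ℕ.+ n) * (ι (2 ℕ.+ n) * (ι (1 ℕ.+ n) * f n)) ∎
  where open ≡-Reasoning

-- Modulo t⁴, g is g₀ + g₁ t + g₂ t²/2! + g₃ t³/3!; since `X²` and `X³` have the coefficients 2! and
-- 3!, they enter with `inv 2` and `inv 6`.
⊛-drop₄ : ∀ f g n → (f ⊛ g) (3 ℕ.+ n) ≡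
  g 0 * f (3 ℕ.+ n) + g 1 * (ι (3 ℕ.+ n) * f (2 ℕ.+ n))
  + (g 2 * inv 2 * (ι (3 ℕ.+ n) * (ι (2 ℕ.+ n) * f (1 ℕ.+ n)))
     + g 3 * inv 6 * (ι (3 ℕ.+ n) * (ι (2 ℕ.+ n) * (ι (1 ℕ.+ n) * f n)))
     + (f ⊛ drop 4 g) (3 ℕ.+ n))
⊛-drop₄ f g n = trans (⊛-drop₂ f g (2 ℕ.+ n)) (cong (_+_ (g 0 * f (3 ℕ.+ n) + g 1 * (ι (3 ℕ.+ n) * f (2 ℕ.+ n)))) (begin
  (f ⊛ drop 2 g) N                                            ≡⟨ ⊛-congˡ g≗ N ⟩
  (f ⊛ (scaled c₂ X² ⊕ scaled c₃ X³ ⊕ drop 4 g)) N            ≡⟨ ⊛-distribˡ f (scaled c₂ X² ⊕ scaled c₃ X³) (drop 4 g) N ⟩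
  (f ⊛ (scaled c₂ X² ⊕ scaled c₃ X³)) N + R                   ≡⟨ cong (_+ R) (⊛-distribˡ f (scaled c₂ X²) (scaled c₃ X³) N) ⟩
  (f ⊛ scaled c₂ X²) N + (f ⊛ scaled c₃ X³) N + R             ≡⟨ cong₂ (λ x y → x + y + R) (trans (⊛-scaleʳ c₂ f X² N) (cong (c₂ *_) (⊛-X² f (suc n)))) (trans (⊛-scaleʳ c₃ f X³ N) (cong (c₃ *_) (⊛-X³ f n))) ⟩
  c₂ * (ι (3 ℕ.+ n) * (ι (2 ℕ.+ n) * f (1 ℕ.+ n))) + c₃ * (ι (3 ℕ.+ n) * (ι (2 ℕ.+ n) * (ι (1 ℕ.+ n) * f n))) + R ∎))
  where
  open ≡-Reasoning
  N = 3 ℕ.+ n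
  c₂ = g 2 * inv 2
  c₃ = g 3 * inv 6
  R = (f ⊛ drop 4 g) N
  g≗ : drop 2 g ≗ scaled c₂ X² ⊕ scaled c₃ X³ ⊕ drop 4 g
  g≗ 0 = ((∀ x y → 0ℚ ≡ x * inv 2 * 0ℚ + y * inv 6 * 0ℚ + 0ℚ) ∋ solve-∀ ℚ-ring) (g 2) (g 3)
  g≗ 1 = ((∀ x y → 0ℚ ≡ x * inv 2 * 0ℚ + y * inv 6 * 0ℚ + 0ℚ) ∋ solve-∀ ℚ-ring) (g 2) (g 3)
  g≗ 2 = ((∀ x y → x ≡ x * inv 2 * ι 2 + y * inv 6 * 0ℚ + 0ℚ) ∋ solve-∀ ℚ-ring) (g 2) (g 3)
  g≗ 3 = ((∀ x y → y ≡ x * inv 2 * 0ℚ + y * inv 6 * ι 6 + 0ℚ) ∋ solve-∀ ℚ-ring) (g 2) (g 3)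
  g≗ (suc (suc (suc (suc k)))) = sym (trans
    (cong₂ (λ x y → c₂ * x + c₃ * y + g (4 ℕ.+ k)) (X²-vanish (suc k)) (trans (X⊛-suc X² (3 ℕ.+ k)) (cong (ι (4 ℕ.+ k) *_) (X²-vanish k))))
    (((∀ x y z w → x * 0ℚ + y * (z * 0ℚ) + w ≡ w) ∋ solve-∀ ℚ-ring) c₂ c₃ (ι (4 ℕ.+ k)) (g (4 ℕ.+ k))))

-- Doubling, finite sums and finite products.

double≡+ : ∀ n → double n ≡ n ℕ.+ n
double≡+ zero    = refl
double≡+ (suc n) = cong suc (trans (cong suc (double≡+ n)) (sym (ℕ.+-suc n n)))

double-+ : ∀ m n → double (m ℕ.+ n) ≡ double m ℕ.+ double n
double-+ zero    n = refl
double-+ (suc m) n = cong (suc ∘ suc) (double-+ m n)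

double-* : ∀ m n → m ℕ.* double n ≡ double (m ℕ.* n)
double-* zero    n = refl
double-* (suc m) n = trans (cong (double n ℕ.+_) (double-* m n)) (sym (double-+ n (m ℕ.* n)))

*-^ : ∀ x y n → (x * y) ^ n ≡ x ^ n * y ^ n
*-^ x y zero    = refl
*-^ x y (suc n) = trans (cong (x * y *_) (*-^ x y n))
  (((∀ x y a b → x * y * (a * b) ≡ x * a * (y * b)) ∋ solve-∀ ℚ-ring) x y (x ^ n) (y ^ n))

Σ<-split : ∀ m n f → Σ< (m ℕ.+ n) f ≡ Σ< m f + Σ< n (λ k → f (m ℕ.+ k))
Σ<-split zero    n f = sym (ℚ.+-identityˡ (Σ< n f))
Σ<-split (suc m) n f = trans (cong (_+_ (f 0)) (Σ<-split m n (D f))) (sym (ℚ.+-assoc (f 0) (Σ< m (D f)) (Σ< n (λ k → f (suc m ℕ.+ k)))))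

Σ<-double : ∀ n f → Σ< (double n) f ≡ Σ< n (λ k → f (double k) + f (suc (double k)))
Σ<-double zero    f = refl
Σ<-double (suc n) f = trans (cong (λ x → f 0 + (f 1 + x)) (Σ<-double n (D (D f)))) (sym (ℚ.+-assoc (f 0) (f 1) (Σ< n _)))

Π< : ℕ → Seq → ℚ
Π< zero    f = 1ℚ
Π< (suc n) f = Π< n f * f n

Π<-cong : ∀ n {f g : Seq} → f ≗ g → Π< n f ≡ Π< n g
Π<-cong zero    f≗g = refl
Π<-cong (suc n) f≗g = cong₂ _*_ (Π<-cong n f≗g) (f≗g n)

Π<-^ : ∀ m n f → Π< n (λ k → f k ^ m) ≡ Π< n f ^ m
Π<-^ m zero    f = sym (1^n m)
Π<-^ m (suc n) f = trans (cong (_* f n ^ m) (Π<-^ m n f)) (sym (*-^ (Π< n f) (f n) m))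

Π<-const : ∀ n c → Π< n (λ _ → c) ≡ c ^ n
Π<-const zero    c = refl
Π<-const (suc n) c = trans (ℚ.*-comm (Π< n (λ _ → c)) c) (cong (c *_) (Π<-const n c))

Π<-factorial : ∀ n → Π< n (λ k → ι (suc k)) ≡ ι (n !)
Π<-factorial zero    = refl
Π<-factorial (suc n) = trans (cong (_* ι (suc n)) (Π<-factorial n)) (trans (ℚ.*-comm (ι (n !)) (ι (suc n))) (sym (ι-* (suc n) (n !))))

-- Congruences modulo powers of p and the truncated logarithm.

module Congruences (p : ℕ) (p-prime : Prime p) where
  open Localisation p p-prime

  ∈-resp : ∀ {k x y} → x ≡ y → x ∈p^ k → y ∈p^ k
  ∈-resp {k} = subst (_∈p^ k)

  1∈ : 1ℚ ∈p^ 0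
  1∈ = ι∈ 1

  ^∈ : ∀ {x} n → x ∈p^ 0 → x ^ n ∈p^ 0
  ^∈ zero    x∈ = 1∈
  ^∈ (suc n) x∈ = x∈ ·∈ ^∈ n x∈

  Σ∈ : ∀ {i f} n → (∀ {k} → k ℕ.< n → f k ∈p^ i) → Σ< n f ∈p^ i
  Σ∈ zero    f∈ = zero∈
  Σ∈ (suc n) f∈ = +∈ (f∈ (s≤s z≤n)) (Σ∈ n (f∈ ∘ s≤s))

  cong-sym : ∀ {k x y} → x ≡ y [p^ k ] → y ≡ x [p^ k ]
  cong-sym {x = x} {y} x≡y = ∈-resp (((∀ x y → - (x - y) ≡ y - x) ∋ solve-∀ ℚ-ring) x y) (-∈ x≡y)

  cong-trans : ∀ {k x y z} → x ≡ y [p^ k ] → y ≡ z [p^ k ] → x ≡ z [p^ k ]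
  cong-trans {x = x} {y} {z} x≡y y≡z = ∈-resp (((∀ x y z → (x - y) + (y - z) ≡ x - z) ∋ solve-∀ ℚ-ring) x y z) (+∈ x≡y y≡z)

  ^-cong-mod : ∀ {k x y} n → x ∈p^ 0 → y ∈p^ 0 → x ≡ y [p^ k ] → x ^ n ≡ y ^ n [p^ k ]
  ^-cong-mod zero    x∈ y∈ x≡y = zero∈
  ^-cong-mod {k} {x} {y} (suc n) x∈ y∈ x≡y = ∈-resp
    (((∀ x y a b → x * (a - b) + b * (x - y) ≡ x * a - y * b) ∋ solve-∀ ℚ-ring) x y (x ^ n) (y ^ n))
    (+∈ (x∈ ·∈ ^-cong-mod n x∈ y∈ x≡y) (^∈ n y∈ ·∈ x≡y))

  Σ-cong-mod : ∀ {k f g} n → (∀ {j} → j ℕ.< n → f j ≡ g j [p^ k ]) → Σ< n f ≡ Σ< n g [p^ k ]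
  Σ-cong-mod {f = f} {g} zero    f≡g = zero∈
  Σ-cong-mod {f = f} {g} (suc n) f≡g = ∈-resp
    (((∀ a b c d → (a - b) + (c - d) ≡ (a + c) - (b + d)) ∋ solve-∀ ℚ-ring) (f 0) (g 0) (Σ< n (D f)) (Σ< n (D g)))
    (+∈ (f≡g (s≤s z≤n)) (Σ-cong-mod n (f≡g ∘ s≤s)))

  -- Cancels the unit c + p w without inverting it: once d is in p^k, the term p w d is in p^(k+1)
  -- and can be subtracted, leaving c d.
  /unit+p∈ : ∀ {d w} k c → ¬ p ∣ c → d ∈p^ 0 → w ∈p^ 0 → ι c * d + ι p * (w * d) ∈p^ k → d ∈p^ k
  /unit+p∈ zero c p∤c d∈ w∈ _ = d∈
  /unit+p∈ {d} {w} (suc k) c p∤c d∈ w∈ x∈ = /unit∈ c p∤c (∈-resp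
    (((∀ x y → x + y - y ≡ x) ∋ solve-∀ ℚ-ring) (ι c * d) (ι p * (w * d)))
    (+∈ x∈ (-∈ (p*∈ (w∈ ·∈ /unit+p∈ k c p∤c d∈ w∈ (weaken (ℕ.n≤1+n k) x∈))))))

  taylor₁ : ∀ {x z} n → x ∈p^ 0 → z ∈p^ 0 → (x + ι p * z) ^ suc n ≡ x ^ suc n + ι (suc n) * x ^ n * (ι p * z) [p^ 2 ]
  taylor₁ {x} {z} zero x∈ z∈ = ∈-resp (sym (((∀ x e → (x + e) * 1ℚ - (x * 1ℚ + ι 1 * 1ℚ * e) ≡ 0ℚ) ∋ solve-∀ ℚ-ring) x (ι p * z))) zero∈
  taylor₁ {x} {z} (suc n) x∈ z∈ = ∈-resp
    (((∀ x e y a i → (x + e) * (a - (x * y + i * y * e)) + i * y * (e * e)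
         ≡ (x + e) * a - (x * (x * y) + (1ℚ + i) * (x * y) * e)) ∋ solve-∀ ℚ-ring) x (ι p * z) (x ^ n) ((x + ι p * z) ^ suc n) (ι (suc n)))
    (+∈ (+∈ x∈ (weaken z≤n pz∈) ·∈ taylor₁ n x∈ z∈) ((ι∈ (suc n) ·∈ ^∈ n x∈) ·∈ *∈ pz∈ pz∈))
    where
    pz∈ : ι p * z ∈p^ 1
    pz∈ = p*∈ z∈

  1+pz-^ : ∀ {z} n → z ∈p^ 0 → (1ℚ + ι p * z) ^ n ≡ 1ℚ + ι n * (ι p * z) [p^ 2 ]
  1+pz-^ {z} zero z∈ = ∈-resp (sym (((∀ e → 1ℚ - (1ℚ + 0ℚ * e) ≡ 0ℚ) ∋ solve-∀ ℚ-ring) (ι p * z))) zero∈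
  1+pz-^ {z} (suc n) z∈ = ∈-resp
    (cong (λ y → (1ℚ + ι p * z) ^ suc n - y) (trans (cong (λ y → 1ℚ * y + ι (suc n) * y * (ι p * z)) (1^n n))
      (((∀ i e → 1ℚ * 1ℚ + i * 1ℚ * e ≡ 1ℚ + i * e) ∋ solve-∀ ℚ-ring) (ι (suc n)) (ι p * z))))
    (taylor₁ n 1∈ z∈)

  -- Σ log (1 + p f) / p cut after three terms, in the power sums of f.
  logSeries : ℚ → ℚ → ℚ → ℚ
  logSeries s₁ s₂ s₃ = s₁ - inv 2 * ι p * s₂ + inv 3 * (ι p * ι p) * s₃

  -- 6 (e₁ + p e₂ + p² e₃), the elementary symmetric functions being written in power sums by Newton's identities.
  newton : ℚ → ℚ → ℚ → ℚ
  newton s₁ s₂ s₃ = ι 6 * s₁ + ι 3 * ι p * (s₁ * s₁ - s₂) + ι p * ι p * (s₁ * s₁ * s₁ - ι 3 * s₁ * s₂ + ι 2 * s₃)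

  newtonSum : ℕ → Seq → ℚ
  newtonSum n f = newton (Σ< n f) (Σ< n (λ k → f k * f k)) (Σ< n (λ k → f k * f k * f k))

  -- The 6 clears the denominators of Newton's identities. Multiplying by one more factor 1 + p x,
  -- the only new error is p⁴ x times 6 e₃.
  Π-newton : ∀ {f} n → (∀ {k} → k ℕ.< n → f k ∈p^ 0) →
    ι 6 * Π< n (λ k → 1ℚ + ι p * f k) ≡ ι 6 + ι p * newtonSum n f [p^ 4 ]
  Π-newton zero f∈ = ∈-resp (sym (((∀ p → ι 6 * 1ℚ - (ι 6 + p * (ι 6 * 0ℚ + ι 3 * p * (0ℚ * 0ℚ - 0ℚ) + p * p * (0ℚ * 0ℚ * 0ℚ - ι 3 * 0ℚ * 0ℚ + ι 2 * 0ℚ))) ≡ 0ℚ) ∋ solve-∀ ℚ-ring) (ι p))) zero∈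
  Π-newton {f} (suc n) f∈ = ∈-resp eq (+∈ (+∈ 1∈ (weaken z≤n (p*∈ x∈)) ·∈ Π-newton n f∈′) (*∈ (*∈ p∈ (*∈ p∈ (*∈ p∈ p∈))) (x∈ ·∈ e₃∈)))
    where
    f∈′ : ∀ {k} → k ℕ.< n → f k ∈p^ 0
    f∈′ k<n = f∈ (ℕ.m<n⇒m<1+n k<n)
    x = f n
    s₁ = Σ< n f
    s₂ = Σ< n (λ k → f k * f k)
    s₃ = Σ< n (λ k → f k * f k * f k)
    π = Π< n (λ k → 1ℚ + ι p * f k)
    x∈ : x ∈p^ 0
    x∈ = f∈ ℕ.≤-refl
    s₁∈ : s₁ ∈p^ 0
    s₁∈ = Σ∈ n f∈′
    s₂∈ : s₂ ∈p^ 0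
    s₂∈ = Σ∈ n (λ k<n → f∈′ k<n ·∈ f∈′ k<n)
    s₃∈ : s₃ ∈p^ 0
    s₃∈ = Σ∈ n (λ k<n → (f∈′ k<n ·∈ f∈′ k<n) ·∈ f∈′ k<n)
    e₃ = s₁ * s₁ * s₁ - ι 3 * s₁ * s₂ + ι 2 * s₃
    e₃∈ : e₃ ∈p^ 0
    e₃∈ = +∈ (+∈ ((s₁∈ ·∈ s₁∈) ·∈ s₁∈) (-∈ ((ι∈ 3 ·∈ s₁∈) ·∈ s₂∈))) (ι∈ 2 ·∈ s₃∈)
    step : ∀ p x s₁ s₂ s₃ π →
      (1ℚ + p * x) * (ι 6 * π - (ι 6 + p * (ι 6 * s₁ + ι 3 * p * (s₁ * s₁ - s₂) + p * p * (s₁ * s₁ * s₁ - ι 3 * s₁ * s₂ + ι 2 * s₃))))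
        + (p * (p * (p * p))) * (x * (s₁ * s₁ * s₁ - ι 3 * s₁ * s₂ + ι 2 * s₃))
      ≡ ι 6 * (π * (1ℚ + p * x)) - (ι 6 + p * (ι 6 * (s₁ + x) + ι 3 * p * ((s₁ + x) * (s₁ + x) - (s₂ + x * x))
          + p * p * ((s₁ + x) * (s₁ + x) * (s₁ + x) - ι 3 * (s₁ + x) * (s₂ + x * x) + ι 2 * (s₃ + x * x * x))))
    step = solve-∀ ℚ-ring
    eq : (1ℚ + ι p * x) * (ι 6 * π - (ι 6 + ι p * newtonSum n f)) + (ι p * (ι p * (ι p * ι p))) * (x * e₃)
       ≡ ι 6 * (π * (1ℚ + ι p * x)) - (ι 6 + ι p * newtonSum (suc n) f)
    eq = trans (step (ι p) x s₁ s₂ s₃ π) (cong (λ y → ι 6 * (π * (1ℚ + ι p * x)) - (ι 6 + ι p * y)) (sym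
      (trans (cong (λ y → newton y (Σ< (suc n) (λ k → f k * f k)) (Σ< (suc n) (λ k → f k * f k * f k))) (Σ<-last n f))
        (cong₂ (newton (s₁ + x)) (Σ<-last n (λ k → f k * f k)) (Σ<-last n (λ k → f k * f k * f k))))))

  -- Six times (e^(pL) - 1) / p, cut after three terms.
  6L+3pL²+p²L³ : ℚ → ℚ
  6L+3pL²+p²L³ l = ι 6 * l + ι 3 * ι p * (l * l) + ι p * ι p * (l * l * l)

  2≤6 : 2 ℕ.≤ 6
  2≤6 = s≤s (s≤s z≤n)

  3≤6 : 3 ℕ.≤ 6
  3≤6 = s≤s (s≤s (s≤s z≤n))

  p²∈ : ι p * ι p ∈p^ 2
  p²∈ = *∈ p∈ p∈

  p³∈ : ι p * (ι p * ι p) ∈p^ 3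
  p³∈ = *∈ p∈ p²∈

  module _ (7≤p : 7 ℕ.≤ p) where
    p∤small : ∀ n .{{_ : ℕ.NonZero n}} → n ℕ.≤ 6 → ¬ p ∣ n
    p∤small n n≤6 p∣n = ℕ.<⇒≱ (s≤s n≤6) (ℕ.≤-trans 7≤p (ℕ∣.∣⇒≤ p∣n))

    inv∈ : ∀ n .{{_ : ℕ.NonZero n}} → n ℕ.≤ 6 → inv n ∈p^ 0
    inv∈ n n≤6 = 0∈ (integral-inv (p∤small n n≤6))

    logSeries∈ : ∀ {s₁ s₂ s₃} → s₁ ∈p^ 0 → s₂ ∈p^ 0 → s₃ ∈p^ 0 → logSeries s₁ s₂ s₃ ∈p^ 0
    logSeries∈ s₁∈ s₂∈ s₃∈ = +∈ (+∈ s₁∈ (-∈ ((inv∈ 2 2≤6 ·∈ weaken z≤n p∈) ·∈ s₂∈))) ((inv∈ 3 3≤6 ·∈ weaken z≤n p²∈) ·∈ s₃∈)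

    -- The truncated form of exp ∘ log = id; the proof exhibits the remainder as p³ times an
    -- integral polynomial.
    newton≡exp-log : ∀ {s₁ s₂ s₃} → s₁ ∈p^ 0 → s₂ ∈p^ 0 → s₃ ∈p^ 0 →
      newton s₁ s₂ s₃ ≡ 6L+3pL²+p²L³ (logSeries s₁ s₂ s₃) [p^ 3 ]
    newton≡exp-log {s₁} {s₂} {s₃} s₁∈ s₂∈ s₃∈ = ∈-resp (ring (ι p) s₁ s₂ s₃)
      (p³∈ *∈₀ +∈ (+∈ (+∈ (+∈ (ιℤ∈ (ℤ.- (+ 2)) ·∈ (s₁∈ ·∈ s₃∈)) (-∈ (ι∈ 3 ·∈ (y∈ ·∈ y∈)))) (ι∈ 3 ·∈ ((s₁∈ ·∈ s₁∈) ·∈ y∈)))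
          (-∈ ((ι∈ 3 ·∈ weaken z≤n p∈) ·∈ (s₁∈ ·∈ (y∈ ·∈ y∈))))) (weaken z≤n p²∈ ·∈ (y∈ ·∈ (y∈ ·∈ y∈))))
      where
      _*∈₀_ : ∀ {k x y} → x ∈p^ k → y ∈p^ 0 → x * y ∈p^ k
      _*∈₀_ {k} {x} {y} x∈ y∈ = ∈-resp (ℚ.*-comm y x) (y∈ ·∈ x∈)
      -- This is (s₁ - L) / p for L = `logSeries s₁ s₂ s₃`, which allows p³ to be factored out of
      -- the remainder explicitly.
      y = inv 2 * s₂ - inv 3 * ι p * s₃
      y∈ : y ∈p^ 0
      y∈ = +∈ (inv∈ 2 2≤6 ·∈ s₂∈) (-∈ ((inv∈ 3 3≤6 ·∈ weaken z≤n p∈) ·∈ s₃∈))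
      ring : ∀ p s₁ s₂ s₃ → let y = inv 2 * s₂ - inv 3 * p * s₃ ; l = s₁ - inv 2 * p * s₂ + inv 3 * (p * p) * s₃ in
        (p * (p * p)) * (ιℤ (ℤ.- (+ 2)) * (s₁ * s₃) + - (ι 3 * (y * y)) + ι 3 * ((s₁ * s₁) * y) + - ((ι 3 * p) * (s₁ * (y * y))) + (p * p) * (y * (y * y)))
        ≡ ι 6 * s₁ + ι 3 * p * (s₁ * s₁ - s₂) + p * p * (s₁ * s₁ * s₁ - ι 3 * s₁ * s₂ + ι 2 * s₃)
          - (ι 6 * l + ι 3 * p * (l * l) + p * p * (l * l * l))
      ring = solve-∀ ℚ-ring

    -- The truncated exponential is injective modulo p³: its difference at l and m is (l - m) times
    -- 6 plus a multiple of p, a unit.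
    newton≡⇒log≡ : ∀ {s₁ s₂ s₃ t₁ t₂ t₃} → s₁ ∈p^ 0 → s₂ ∈p^ 0 → s₃ ∈p^ 0 → t₁ ∈p^ 0 → t₂ ∈p^ 0 → t₃ ∈p^ 0 →
      newton s₁ s₂ s₃ ≡ newton t₁ t₂ t₃ [p^ 3 ] → logSeries s₁ s₂ s₃ ≡ logSeries t₁ t₂ t₃ [p^ 3 ]
    newton≡⇒log≡ {s₁} {s₂} {s₃} {t₁} {t₂} {t₃} s₁∈ s₂∈ s₃∈ t₁∈ t₂∈ t₃∈ eq = /unit+p∈ 3 6 (p∤small 6 ℕ.≤-refl) (+∈ l∈ (-∈ m∈))
        (+∈ (ι∈ 3 ·∈ +∈ l∈ m∈) (weaken z≤n p∈ ·∈ (+∈ (+∈ (l∈ ·∈ l∈) (l∈ ·∈ m∈)) (m∈ ·∈ m∈))))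
        (∈-resp (ring (ι p) l m) (cong-trans {x = 6L+3pL²+p²L³ l} {newton s₁ s₂ s₃} {6L+3pL²+p²L³ m} (cong-sym {x = newton s₁ s₂ s₃} {6L+3pL²+p²L³ l} (newton≡exp-log s₁∈ s₂∈ s₃∈))
            (cong-trans {x = newton s₁ s₂ s₃} {newton t₁ t₂ t₃} {6L+3pL²+p²L³ m} eq (newton≡exp-log t₁∈ t₂∈ t₃∈))))
      where
      l = logSeries s₁ s₂ s₃
      m = logSeries t₁ t₂ t₃
      l∈ : l ∈p^ 0
      l∈ = logSeries∈ s₁∈ s₂∈ s₃∈
      m∈ : m ∈p^ 0
      m∈ = logSeries∈ t₁∈ t₂∈ t₃∈
      ring : ∀ p l m → (ι 6 * l + ι 3 * p * (l * l) + p * p * (l * l * l)) - (ι 6 * m + ι 3 * p * (m * m) + p * p * (m * m * m))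
        ≡ ι 6 * (l - m) + p * ((ι 3 * (l + m) + p * (l * l + l * m + m * m)) * (l - m))
      ring = solve-∀ ℚ-ring

-- The p-adic size of the terms in Faulhaber's formula.

module BernoulliEstimates (p : ℕ) (p-prime : Prime p) (7≤p : 7 ℕ.≤ p) where
  open Localisation p p-prime
  open Congruences p p-prime

  ⊛-∈ : ∀ {i f g} n → (∀ {k} → k ℕ.≤ n → f k ∈p^ 0) → (∀ k → g k ∈p^ i) → (f ⊛ g) n ∈p^ i
  ⊛-∈ zero    f∈ g∈ = f∈ ℕ.≤-refl ·∈ g∈ 0
  ⊛-∈ (suc n) f∈ g∈ = +∈ (⊛-∈ n (f∈ ∘ s≤s) g∈) (⊛-∈ n (f∈ ∘ ℕ.m≤n⇒m≤1+n) (g∈ ∘ suc))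

  -- Without a constant term in g, `f n` does not enter the coefficient; this is the form a strong
  -- induction on f requires.
  ⊛-∈-< : ∀ {i f g} n → (∀ {k} → k ℕ.< n → f k ∈p^ 0) → g 0 ≡ 0ℚ → (∀ k → g k ∈p^ i) → (f ⊛ g) n ∈p^ i
  ⊛-∈-< {i} {f} zero f∈ g0≡0 g∈ = subst (_∈p^ i) (sym (trans (cong (f 0 *_) g0≡0) (ℚ.*-zeroʳ (f 0)))) zero∈
  ⊛-∈-< (suc n) f∈ g0≡0 g∈ = +∈ (⊛-∈-< n (f∈ ∘ s≤s) g0≡0 g∈) (⊛-∈ n (f∈ ∘ s≤s) (g∈ ∘ suc))

  inv-*p : ∀ q .{{_ : ℕ.NonZero q}} → ι p * inv (q ℕ.* p) ≡ inv q
  inv-*p q = ι-cancel q (begin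
    ι q * (ι p * inv (q ℕ.* p))      ≡⟨ ℚ.*-assoc (ι q) (ι p) (inv (q ℕ.* p)) ⟨
    ι q * ι p * inv (q ℕ.* p)        ≡⟨ cong (_* inv (q ℕ.* p)) (ι-* q p) ⟨
    ι (q ℕ.* p) * inv (q ℕ.* p)      ≡⟨ ι*inv-nonZero (q ℕ.* p) {{ℕ.m*n≢0 q p}} ⟩
    1ℚ                               ≡⟨ ι*inv-nonZero q ⟨
    ι q * inv q                      ∎)
    where open ≡-Reasoning

  -- v counts the factors p of n, removed one at a time by well-founded recursion.
  p-adic-order : ∀ n .{{_ : ℕ.NonZero n}} → ∃ λ v → Integral (ι p ^ v * inv n) × p ℕ.^ v ℕ.≤ n
  p-adic-order n {{n≢0}} = <-rec (λ n → .(ℕ.NonZero n) → ∃ λ v → Integral (ι p ^ v * inv n) × p ℕ.^ v ℕ.≤ n) step n n≢0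
    where
    step : ∀ n → (∀ {m} → m ℕ.< n → .(ℕ.NonZero m) → ∃ λ v → Integral (ι p ^ v * inv m) × p ℕ.^ v ℕ.≤ m) →
           .(ℕ.NonZero n) → ∃ λ v → Integral (ι p ^ v * inv n) × p ℕ.^ v ℕ.≤ n
    step n rec n≢0 with p ∣? n
    ... | no p∤n = 0 , integral-* (integral-ι 1) (integral-inv p∤n) , ℕ.>-nonZero⁻¹ n {{n≢0}}
    ... | yes (divides zero refl) = contradiction refl (ℕ.≢-nonZero⁻¹ 0 {{n≢0}})
    ... | yes (divides q@(suc _) refl) with rec (ℕ.m<m*n q p (ℕ.≤-trans (s≤s (s≤s z≤n)) 7≤p)) _
    ...   | v , int , p^v≤q = suc v , subst Integral eq int , subst (p ℕ.* p ℕ.^ v ℕ.≤_) (ℕ.*-comm p q) (ℕ.*-monoʳ-≤ p p^v≤q)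
      where
      eq : ι p ^ v * inv q ≡ ι p * ι p ^ v * inv (q ℕ.* p)
      eq = trans (cong (ι p ^ v *_) (sym (inv-*p q)))
        (((∀ x y z → x * (y * z) ≡ y * x * z) ∋ solve-∀ ℚ-ring) (ι p ^ v) (ι p) (inv (q ℕ.* p)))

  7+v≤p^1+v : ∀ v → 7 ℕ.+ v ℕ.≤ p ℕ.^ suc v
  7+v≤p^1+v zero    = ℕ.≤-trans 7≤p (ℕ.≤-reflexive (sym (ℕ.*-identityʳ p)))
  7+v≤p^1+v (suc v) = begin
    7 ℕ.+ suc v                           ≡⟨ ℕ.+-suc 7 v ⟩
    suc (7 ℕ.+ v)                         ≤⟨ ℕ.+-mono-≤ (s≤s (z≤n {6 ℕ.+ v})) (ℕ.m≤m+n (7 ℕ.+ v) 0) ⟩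
    2 ℕ.* (7 ℕ.+ v)                       ≤⟨ ℕ.*-mono-≤ (ℕ.≤-trans (s≤s (s≤s z≤n)) 7≤p) (7+v≤p^1+v v) ⟩
    p ℕ.* p ℕ.^ suc v                     ∎
    where open ℕ.≤-Reasoning

  H : Seq
  H = faulhaberKernel (ι p)

  -- Dividing p^k by k+1 costs v powers of p with p^v ≤ k+1. If v ≥ 1, then `7+v≤p^1+v` gives k ≥ v
  -- + 5, so at least four powers are left. For p = 5 and k = 4 only three would be.
  H∈ : ∀ {j} k → j ℕ.≤ 4 → j ℕ.≤ k → H k ∈p^ j
  H∈ {j} k j≤4 j≤k with p-adic-order (suc k)
  ... | v , int , p^v≤1+k = weaken (ℕ.≤-trans (ℕ.≤-reflexive (sym (ℕ.m+n∸m≡n v j))) (ℕ.∸-monoˡ-≤ v (v+j≤k v p^v≤1+k)))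
      (multiple (ι p ^ v * inv (suc k)) eq int)
    where
    v+j≤k : ∀ v → p ℕ.^ v ℕ.≤ suc k → v ℕ.+ j ℕ.≤ k
    v+j≤k zero    _  = j≤k
    v+j≤k (suc v) p^ = ℕ.≤-pred (begin
      2 ℕ.+ v ℕ.+ j        ≤⟨ ℕ.+-monoʳ-≤ (2 ℕ.+ v) j≤4 ⟩
      2 ℕ.+ v ℕ.+ 4        ≡⟨ ℕ.+-comm (2 ℕ.+ v) 4 ⟩
      6 ℕ.+ v              ≤⟨ ℕ.n≤1+n (6 ℕ.+ v) ⟩
      7 ℕ.+ v              ≤⟨ ℕ.≤-trans (7+v≤p^1+v v) p^ ⟩
      suc k                ∎)
      where open ℕ.≤-Reasoning
    v≤k : v ℕ.≤ k
    v≤k = ℕ.≤-trans (ℕ.m≤m+n v j) (v+j≤k v p^v≤1+k)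
    eq : H k ≡ ι p ^ (k ℕ.∸ v) * (ι p ^ v * inv (suc k))
    eq = trans (cong (λ m → ι p ^ m * inv (suc k)) (sym (ℕ.m∸n+n≡m v≤k)))
      (trans (cong (_* inv (suc k)) (^-+ (ι p) (k ℕ.∸ v) v)) (ℚ.*-assoc (ι p ^ (k ℕ.∸ v)) (ι p ^ v) (inv (suc k))))

  drop∈ : ∀ {i f} j → (∀ k → f (j ℕ.+ k) ∈p^ i) → ∀ k → drop j f k ∈p^ i
  drop∈ zero    f∈ k       = f∈ k
  drop∈ (suc j) f∈ zero    = zero∈
  drop∈ (suc j) f∈ (suc k) = drop∈ j f∈ k

  drop-H∈ : ∀ j → j ℕ.≤ 4 → ∀ k → drop j H k ∈p^ j
  drop-H∈ j j≤4 = drop∈ j (λ k → H∈ (j ℕ.+ k) j≤4 (ℕ.m≤m+n j k))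

  pB : Seq
  pB k = ι p * B k

  P : Seq
  P = powerSum p

  P∈ : ∀ m → P m ∈p^ 0
  P∈ m = Σ∈ p (λ {a} _ → ^∈ m (ι∈ a))

  -- The integral half of von Staudt-Clausen, by strong induction: in Faulhaber's formula for the
  -- integer `P m` the leading term is `pB m`, and all others combine earlier `pB k` with integral
  -- coefficients.
  pB∈ : ∀ m → pB m ∈p^ 0
  pB∈ = <-rec (λ m → pB m ∈p^ 0) (λ m rec → subst (_∈p^ 0) (eq m)
      (+∈ (P∈ m) (-∈ (⊛-∈-< m rec refl (λ k → weaken z≤n (drop-H∈ 1 (s≤s z≤n) k))))))
    where
    eq : ∀ m → P m + - (pB ⊛ drop 1 H) m ≡ pB m
    eq m = trans (cong (_+ - (pB ⊛ drop 1 H) m) (trans (faulhaber p m) (⊛-drop₁ pB H m)))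
      (((∀ b r → (ι 1 * inv 1) * b + r + - r ≡ b) ∋ solve-∀ ℚ-ring) (pB m) ((pB ⊛ drop 1 H) m))

  pB-odd : ∀ h → pB (3 ℕ.+ double h) ≡ 0ℚ
  pB-odd h = trans (cong (ι p *_) (B-odd h)) (ℚ.*-zeroʳ (ι p))

  -- The exponent is even, so the degree-1 term contains an odd Bernoulli number and vanishes.
  P≡pB[p²] : ∀ h → P (4 ℕ.+ double h) ≡ pB (4 ℕ.+ double h) [p^ 2 ]
  P≡pB[p²] h = subst (_∈p^ 2) (sym eq) (⊛-∈ m (λ {k} _ → pB∈ k) (drop-H∈ 2 (s≤s (s≤s z≤n))))
    where
    m = 4 ℕ.+ double h
    R = (pB ⊛ drop 2 H) m
    eq : P m - pB m ≡ R
    eq = trans (cong (_- pB m) (trans (faulhaber p m) (trans (⊛-drop₂ pB H (3 ℕ.+ double h))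
           (cong (λ z → H 0 * pB m + H 1 * (ι m * z) + R) (pB-odd h)))))
      (((∀ b x y r → (ι 1 * inv 1) * b + x * (y * 0ℚ) + r - b ≡ r) ∋ solve-∀ ℚ-ring) (pB m) (H 1) (ι m) R)

  -- The terms of degree 1 and 3 contain B_(m-1) and B_(m-3), of odd index. The degree-2 term is
  -- (p²/3) C(m,2) p B_(m-2), whence the 1/6.
  P≡pB[p⁴] : ∀ h → let m = 6 ℕ.+ double h in
    P m ≡ pB m + inv 6 * (ι p * ι p) * (ι m * (ι (5 ℕ.+ double h) * pB (4 ℕ.+ double h))) [p^ 4 ]
  P≡pB[p⁴] h = subst (_∈p^ 4) (sym eq) (⊛-∈ m (λ {k} _ → pB∈ k) (drop-H∈ 4 ℕ.≤-refl))
    where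
    n = 3 ℕ.+ double h
    m = 3 ℕ.+ n
    R = (pB ⊛ drop 4 H) m
    eq : P m - (pB m + inv 6 * (ι p * ι p) * (ι m * (ι (2 ℕ.+ n) * pB (1 ℕ.+ n)))) ≡ R
    eq = trans (cong (_- (pB m + inv 6 * (ι p * ι p) * (ι m * (ι (2 ℕ.+ n) * pB (1 ℕ.+ n))))) (trans (faulhaber p m) (trans (⊛-drop₄ pB H n)
           (cong₂ (λ y z → H 0 * pB m + H 1 * (ι m * y) + (H 2 * inv 2 * (ι m * (ι (2 ℕ.+ n) * pB (1 ℕ.+ n))) + H 3 * inv 6 * (ι m * (ι (2 ℕ.+ n) * (ι (1 ℕ.+ n) * z))) + R))
             (pB-odd (suc h)) (pB-odd h)))))
      (((∀ b x i j k c p h₃ r → (1ℚ * inv 1) * b + x * (i * 0ℚ) + ((p * (p * 1ℚ)) * inv 3 * inv 2 * (i * (j * c)) + h₃ * inv 6 * (i * (j * (k * 0ℚ))) + r)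
          - (b + inv 6 * (p * p) * (i * (j * c))) ≡ r) ∋ solve-∀ ℚ-ring) (pB m) (H 1) (ι m) (ι (2 ℕ.+ n)) (ι (1 ℕ.+ n)) (pB (1 ℕ.+ n)) (ι p) (H 3) R)

-- The n-th forward difference of g at 0.
Δ₀ : ℕ → Seq → ℚ
Δ₀ n g = (g ⊛ E (- 1ℚ)) n

Δ₀-suc : ∀ n g → Δ₀ (suc n) g ≡ Δ₀ n (λ k → g (suc k) - g k)
Δ₀-suc n g = begin
  (D g ⊛ E (- 1ℚ)) n + (g ⊛ (λ k → (- 1ℚ) * E (- 1ℚ) k)) n         ≡⟨ cong (_+_ ((D g ⊛ E (- 1ℚ)) n)) (trans (⊛-scaleʳ (- 1ℚ) g (E (- 1ℚ)) n) (sym (⊛-scale (- 1ℚ) g (E (- 1ℚ)) n))) ⟩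
  (D g ⊛ E (- 1ℚ)) n + (scaled (- 1ℚ) g ⊛ E (- 1ℚ)) n              ≡⟨ ⊛-distribʳ (D g) (scaled (- 1ℚ) g) (E (- 1ℚ)) n ⟨
  ((D g ⊕ scaled (- 1ℚ) g) ⊛ E (- 1ℚ)) n                           ≡⟨ ⊛-congʳ (λ k → ((∀ x y → x + (- 1ℚ) * y ≡ x - y) ∋ solve-∀ ℚ-ring) (g (suc k)) (g k)) n ⟩
  Δ₀ n (λ k → g (suc k) - g k)                                     ∎
  where open ≡-Reasoning

-- The shift c serves the induction, since `D h` is the same power shifted by c + 1. Writing k
-- h(k+1) style products as t times a derivative gives (n+1) n!, while the c-part is an (n+1)-st
-- difference in degree n and cancels.
Δ₀-power : ∀ n c → Δ₀ n (λ k → (ι k + c) ^ n) ≡ ι (n !)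
Δ₀-power zero    c = refl
Δ₀-power (suc n) c = begin
  Δ₀ (suc n) (λ k → (ι k + c) * h k)                                ≡⟨ ⊛-congʳ (λ k → trans (ℚ.*-distribʳ-+ (h k) (ι k) c) (cong (_+ c * h k) (sym (X⊛-D h k)))) (suc n) ⟩
  Δ₀ (suc n) (X ⊛ D h ⊕ scaled c h)                                 ≡⟨ ⊛-distribʳ (X ⊛ D h) (scaled c h) (E (- 1ℚ)) (suc n) ⟩
  Δ₀ (suc n) (X ⊛ D h) + Δ₀ (suc n) (scaled c h)                    ≡⟨ cong₂ _+_ (trans (⊛-assoc X (D h) (E (- 1ℚ)) (suc n)) (X⊛-suc (D h ⊛ E (- 1ℚ)) n)) (⊛-scale c h (E (- 1ℚ)) (suc n)) ⟩
  ι (suc n) * Δ₀ n (D h) + c * (Δ₀ n (D h) + (h ⊛ (λ k → (- 1ℚ) * E (- 1ℚ) k)) n)  ≡⟨ cong (λ x → ι (suc n) * Δ₀ n (D h) + c * (Δ₀ n (D h) + x)) (⊛-scaleʳ (- 1ℚ) h (E (- 1ℚ)) n) ⟩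
  ι (suc n) * Δ₀ n (D h) + c * (Δ₀ n (D h) + (- 1ℚ) * Δ₀ n h)       ≡⟨ cong₂ (λ x y → ι (suc n) * x + c * (x + (- 1ℚ) * y)) Dh (Δ₀-power n c) ⟩
  ι (suc n) * ι (n !) + c * (ι (n !) + (- 1ℚ) * ι (n !))            ≡⟨ ((∀ x y z → x * y + z * (y + (- 1ℚ) * y) ≡ x * y) ∋ solve-∀ ℚ-ring) (ι (suc n)) (ι (n !)) c ⟩
  ι (suc n) * ι (n !)                                               ≡⟨ ι-* (suc n) (n !) ⟨
  ι (suc n !)                                                       ∎
  where
  open ≡-Reasoning
  h : Seq
  h k = (ι k + c) ^ n
  Dh : Δ₀ n (D h) ≡ ι (n !)
  Dh = trans (⊛-congʳ (λ k → cong (_^ n) (((∀ x c → (1ℚ + x) + c ≡ x + (1ℚ + c)) ∋ solve-∀ ℚ-ring) (ι k) c)) n) (Δ₀-power n (1ℚ + c))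

neg-neg : ∀ f → neg (neg f) ≗ f
neg-neg f n = trans (sym (ℚ.*-assoc s s (f n))) (trans (cong (_* f n) (s² n)) (ℚ.*-identityˡ (f n)))
  where
  s = (- 1ℚ) ^ n
  s² : ∀ n → (- 1ℚ) ^ n * (- 1ℚ) ^ n ≡ 1ℚ
  s² zero    = refl
  s² (suc n) = trans (((∀ x → (- 1ℚ * x) * (- 1ℚ * x) ≡ x * x) ∋ solve-∀ ℚ-ring) ((- 1ℚ) ^ n)) (s² n)

-- Fermat's little theorem and Wilson's theorem.

module OddPrime (h : ℕ) (p-prime : Prime (suc (double h))) where
  q p : ℕ
  q = double h
  p = suc q

  open Localisation p p-prime
  open Congruences p p-prime

  ∣⇒∈ : ∀ {n} → p ∣ n → ι n ∈p^ 1
  ∣⇒∈ (divides m refl) = subst (_∈p^ 1) (sym (ι-* m p)) (ι∈ m ·∈ p∈)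

  p∤<p : ∀ {n} .{{_ : ℕ.NonZero n}} → n ℕ.< p → ¬ p ∣ n
  p∤<p n<p p∣n = ℕ.<⇒≱ n<p (ℕ∣.∣⇒≤ p∣n)

  p∤! : ∀ n → n ℕ.< p → ¬ p ∣ n !
  p∤! zero    n<p p∣1 = p∤1 p∣1
  p∤! (suc n) n<p = p∤* (p∤<p n<p) (p∤! n (ℕ.<-trans (ℕ.n<1+n n) n<p))

  -- In C(p,k) k! (p-k)! = p! neither factorial on the left is divisible by p.
  p∣pCk : ∀ k → 0 ℕ.< k → k ℕ.< p → p ∣ p C k
  p∣pCk k 0<k k<p with euclidsLemma (p C k) (k ! ℕ.* (p ℕ.∸ k) !) p-prime (subst (p ∣_) (sym eq) (ℕ∣.∣m⇒∣m*n (q !) ℕ∣.∣-refl))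
    where
    eq : (p C k) ℕ.* (k ! ℕ.* (p ℕ.∸ k) !) ≡ p !
    eq = trans (cong (ℕ._* (k ! ℕ.* (p ℕ.∸ k) !)) (nCk≡n!/k![n-k]! (ℕ.<⇒≤ k<p)))
               (m/n*n≡m {{k ℕ.!* (p ℕ.∸ k) !≢0}} (k![n∸k]!∣n! (ℕ.<⇒≤ k<p)))
  ... | inj₁ p∣C = p∣C
  ... | inj₂ p∣!! = contradiction p∣!! (p∤* (p∤! k k<p) (p∤! (p ℕ.∸ k) (ℕ.∸-monoʳ-< 0<k (ℕ.<⇒≤ k<p))))

  -- All inner binomial coefficients vanish modulo p. Stated for sequences, it yields both Fermat's
  -- theorem and the p-th difference.
  ⊛E1≡endpoints : ∀ {f} → (∀ k → f k ∈p^ 0) → (f ⊛ E 1ℚ) p ≡ f 0 + f p [p^ 1 ]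
  ⊛E1≡endpoints {f} f∈ = subst (_∈p^ 1) (sym eq) (Σ∈ q (λ {k} k<q → *∈ (∣⇒∈ (p∣pCk (suc k) (s≤s z≤n) (s≤s k<q))) (f∈ (suc k))))
    where
    open ≡-Reasoning
    c : Seq
    c k = ι (p C k) * f k
    eq : (f ⊛ E 1ℚ) p - (f 0 + f p) ≡ Σ< q (D c)
    eq = begin
      (f ⊛ E 1ℚ) p - (f 0 + f p)                                  ≡⟨ cong (_- (f 0 + f p)) (trans (⊛E1-binomial f p) (Σ<-last p c)) ⟩
      c 0 + Σ< q (D c) + ι (p C p) * f p - (f 0 + f p)             ≡⟨ cong (λ z → c 0 + Σ< q (D c) + ι z * f p - (f 0 + f p)) (nCn≡1 p) ⟩
      ι 1 * f 0 + Σ< q (D c) + ι 1 * f p - (f 0 + f p)             ≡⟨ ((∀ x y z → ι 1 * x + y + ι 1 * z - (x + z) ≡ y) ∋ solve-∀ ℚ-ring) (f 0) (Σ< q (D c)) (f p) ⟩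
      Σ< q (D c)                                                  ∎

  fermat : ∀ a → ι a ^ p ≡ ι a [p^ 1 ]
  fermat zero    = subst (_∈p^ 1) (sym (((∀ x → 0ℚ * x - 0ℚ ≡ 0ℚ) ∋ solve-∀ ℚ-ring) (0ℚ ^ q))) zero∈
  fermat (suc a) = subst (_∈p^ 1) eq (+∈ (⊛E1≡endpoints (λ k → ^∈ k (ι∈ a))) (fermat a))
    where
    eq : (E (ι a) ⊛ E 1ℚ) p - (1ℚ + ι a ^ p) + (ι a ^ p - ι a) ≡ (1ℚ + ι a) ^ p - (1ℚ + ι a)
    eq = trans (((∀ u v w → u - (1ℚ + v) + (v - w) ≡ u - (1ℚ + w)) ∋ solve-∀ ℚ-ring) ((E (ι a) ⊛ E 1ℚ) p) (ι a ^ p) (ι a))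
               (cong (_- (1ℚ + ι a)) (trans (E-⊛ (ι a) 1ℚ p) (cong (_^ p) (ℚ.+-comm (ι a) 1ℚ))))

  fermat-unit : ∀ {a} → ¬ p ∣ a → ι a ^ q ≡ 1ℚ [p^ 1 ]
  fermat-unit {a} p∤a = /unit∈ a p∤a (subst (_∈p^ 1) (((∀ x y → x * y - x ≡ x * (y - 1ℚ)) ∋ solve-∀ ℚ-ring) (ι a) (ι a ^ q)) (fermat a))

  [-1]^q : (- 1ℚ) ^ q ≡ 1ℚ
  [-1]^q = trans (^-double (- 1ℚ) h) (1^n h)

  -- Changing t to -t turns e^(-t) into e^t, so `⊛E1≡endpoints` applies to `neg g`; (-1)^p is -1
  -- because q is even.
  Δ₀-prime : ∀ {g} → (∀ k → g k ∈p^ 0) → Δ₀ p g ≡ g p - g 0 [p^ 1 ]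
  Δ₀-prime {g} g∈ = subst (_∈p^ 1) (sym eq) (ιℤ∈ (ℤ.- (+ 1)) ·∈ ⊛E1≡endpoints (λ k → ^∈ k (ιℤ∈ (ℤ.- (+ 1))) ·∈ g∈ k))
    where
    open ≡-Reasoning
    A = (neg g ⊛ E 1ℚ) p
    neg-g-p : neg g p ≡ - g p
    neg-g-p = trans (cong (λ s → - 1ℚ * s * g p) [-1]^q) (((∀ x → - 1ℚ * 1ℚ * x ≡ - x) ∋ solve-∀ ℚ-ring) (g p))
    Δ₀≡ : Δ₀ p g ≡ (- 1ℚ) * A
    Δ₀≡ = begin
      (g ⊛ E (- 1ℚ)) p                 ≡⟨ ⊛-cong (neg-neg g) neg-E1 p ⟨
      (neg (neg g) ⊛ neg (E 1ℚ)) p     ≡⟨ neg-⊛ (neg g) (E 1ℚ) p ⟨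
      - 1ℚ * (- 1ℚ) ^ q * A            ≡⟨ cong (λ s → - 1ℚ * s * A) [-1]^q ⟩
      - 1ℚ * 1ℚ * A                    ∎
    eq : Δ₀ p g - (g p - g 0) ≡ (- 1ℚ) * (A - (neg g 0 + neg g p))
    eq = begin
      Δ₀ p g - (g p - g 0)                           ≡⟨ cong (_- (g p - g 0)) Δ₀≡ ⟩
      (- 1ℚ) * A - (g p - g 0)                       ≡⟨ ((∀ a x y → (- 1ℚ) * a - (y - x) ≡ (- 1ℚ) * (a - (1ℚ * x + - y))) ∋ solve-∀ ℚ-ring) A (g 0) (g p) ⟩
      (- 1ℚ) * (A - (1ℚ * g 0 + - g p))              ≡⟨ cong (λ z → (- 1ℚ) * (A - (1ℚ * g 0 + z))) neg-g-p ⟨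
      (- 1ℚ) * (A - (neg g 0 + neg g p))             ∎

  -- This is `Δ₀-prime` for the partial sums of g, whose first difference is g and whose value at 0
  -- is empty.
  Δ₀-pred-prime : ∀ {g} → (∀ k → g k ∈p^ 0) → Δ₀ q g ≡ Σ< p g [p^ 1 ]
  Δ₀-pred-prime {g} g∈ = subst (_∈p^ 1) (cong₂ _-_ eq (ℚ.+-identityʳ (Σ< p g))) (Δ₀-prime (λ k → Σ∈ k (λ {j} _ → g∈ j)))
    where
    eq : Δ₀ p (λ n → Σ< n g) ≡ Δ₀ q g
    eq = trans (Δ₀-suc q (λ n → Σ< n g)) (⊛-congʳ (λ k → trans (cong (_- Σ< k g) (Σ<-last k g))
           (((∀ x y → x + y - x ≡ y) ∋ solve-∀ ℚ-ring) (Σ< k g) (g k))) q)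

  -- Finite differences give (p-1)! = Δ^(p-1) x^(p-1), which is Σ_{k<p} k^(p-1) modulo p.
  wilson : .{{_ : ℕ.NonZero q}} → ι (q !) + 1ℚ ∈p^ 1
  wilson = subst (_∈p^ 1) eq (+∈ (+∈ (Δ₀-pred-prime {g} (λ k → ^∈ q (+∈ (ι∈ k) zero∈)))
      (Σ∈ q (λ {k} k<q → subst (λ x → x ^ q ≡ 1ℚ [p^ 1 ]) (sym (ℚ.+-identityʳ (ι (suc k)))) (fermat-unit (p∤<p (s≤s k<q)))))) p∈)
    where
    open ≡-Reasoning
    g : Seq
    g k = (ι k + 0ℚ) ^ q
    0^q : ∀ n .{{_ : ℕ.NonZero n}} → 0ℚ ^ n ≡ 0ℚ
    0^q (suc n) = ℚ.*-zeroˡ (0ℚ ^ n)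
    eq : Δ₀ q g - (g 0 + Σ< q (D g)) + Σ< q (λ k → D g k - 1ℚ) + ι p ≡ ι (q !) + 1ℚ
    eq = begin
      Δ₀ q g - (g 0 + Σ< q (D g)) + Σ< q (λ k → D g k - 1ℚ) + (1ℚ + ι q)
        ≡⟨ cong (λ z → Δ₀ q g - (g 0 + Σ< q (D g)) + z + (1ℚ + ι q)) (trans (Σ<-- q (D g) (λ _ → 1ℚ)) (cong (_-_ (Σ< q (D g))) (Σ<-const q 1ℚ))) ⟩
      Δ₀ q g - (g 0 + Σ< q (D g)) + (Σ< q (D g) - ι q * 1ℚ) + (1ℚ + ι q)
        ≡⟨ cong₂ (λ x y → x - (y + Σ< q (D g)) + (Σ< q (D g) - ι q * 1ℚ) + (1ℚ + ι q)) (Δ₀-power q 0ℚ) (0^q q) ⟩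
      ι (q !) - (0ℚ + Σ< q (D g)) + (Σ< q (D g) - ι q * 1ℚ) + (1ℚ + ι q)
        ≡⟨ ((∀ w s n → w - (0ℚ + s) + (s - n * 1ℚ) + (1ℚ + n) ≡ w + 1ℚ) ∋ solve-∀ ℚ-ring) (ι (q !)) (Σ< q (D g)) (ι q) ⟩
      ι (q !) + 1ℚ ∎

-- Fermat quotients and the instance of Kummer's congruence.

module PowerSums (h : ℕ) (p-prime : Prime (7 ℕ.+ double h)) where
  -- N = (p-1)/2, q = p-1 and e = p-3.
  N q p e : ℕ
  N = 3 ℕ.+ h
  q = double N
  p = suc q
  e = 4 ℕ.+ double h

  7≤p : 7 ℕ.≤ p
  7≤p = ℕ.m≤m+n 7 (double h)

  open Localisation p p-prime
  open Congruences p p-prime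
  open OddPrime N p-prime using (fermat-unit; p∤<p)

  a : Seq
  a k = ι (suc k)

  fermatQuotient : Seq
  fermatQuotient k = (a k ^ q - 1ℚ) * inv p

  a^q : ∀ k → a k ^ q ≡ 1ℚ + ι p * fermatQuotient k
  a^q k = sym (trans (((∀ p r x → 1ℚ + p * ((x - 1ℚ) * r) ≡ 1ℚ + (p * r) * (x - 1ℚ)) ∋ solve-∀ ℚ-ring) (ι p) (inv p) (a k ^ q))
    (trans (cong (λ y → 1ℚ + y * (a k ^ q - 1ℚ)) (ι*inv q)) (((∀ x → 1ℚ + 1ℚ * (x - 1ℚ) ≡ x) ∋ solve-∀ ℚ-ring) (a k ^ q))))

  fermatQuotient∈ : ∀ {k} → k ℕ.< q → fermatQuotient k ∈p^ 0
  fermatQuotient∈ {k} k<q = /p∈ (∈-resp (trans (cong (_- 1ℚ) (a^q k))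
    (((∀ y → 1ℚ + y - 1ℚ ≡ y) ∋ solve-∀ ℚ-ring) (ι p * fermatQuotient k))) (fermat-unit (p∤<p (s≤s k<q))))

  S₁ S₂ S₃ U V : ℚ
  S₁ = Σ< q fermatQuotient
  S₂ = Σ< q (λ k → fermatQuotient k * fermatQuotient k)
  S₃ = Σ< q (λ k → fermatQuotient k * fermatQuotient k * fermatQuotient k)
  U  = Σ< q (λ k → a k ^ e)
  V  = Σ< q (λ k → a k ^ e * fermatQuotient k)

  S₁∈ : S₁ ∈p^ 0
  S₁∈ = Σ∈ q fermatQuotient∈
  S₂∈ : S₂ ∈p^ 0
  S₂∈ = Σ∈ q (λ k<q → fermatQuotient∈ k<q ·∈ fermatQuotient∈ k<q)
  S₃∈ : S₃ ∈p^ 0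
  S₃∈ = Σ∈ q (λ k<q → (fermatQuotient∈ k<q ·∈ fermatQuotient∈ k<q) ·∈ fermatQuotient∈ k<q)
  V∈ : V ∈p^ 0
  V∈ = Σ∈ q (λ {k} k<q → ^∈ e (ι∈ (suc k)) ·∈ fermatQuotient∈ k<q)

  ^-+* : ∀ x m n → x ^ (m ℕ.+ n ℕ.* q) ≡ x ^ m * (x ^ q) ^ n
  ^-+* x m n = trans (^-+ x m (n ℕ.* q)) (cong (x ^ m *_) (^-* n))
    where
    ^-* : ∀ n → x ^ (n ℕ.* q) ≡ (x ^ q) ^ n
    ^-* zero    = refl
    ^-* (suc n) = trans (^-+ x q (n ℕ.* q)) (cong (x ^ q *_) (^-* n))

  Σa^[e+nq] : ∀ n → Σ< q (λ k → a k ^ (e ℕ.+ n ℕ.* q)) ≡ U + ι n * (ι p * V) [p^ 2 ]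
  Σa^[e+nq] n = ∈-resp (cong (_-_ (Σ< q (λ k → a k ^ (e ℕ.+ n ℕ.* q)))) eq)
    (Σ-cong-mod {f = λ k → a k ^ (e ℕ.+ n ℕ.* q)} {λ k → a k ^ e + np * (a k ^ e * fermatQuotient k)} q term)
    where
    np = ι n * ι p
    eq : Σ< q (λ k → a k ^ e + np * (a k ^ e * fermatQuotient k)) ≡ U + ι n * (ι p * V)
    eq = trans (Σ<-+ q (λ k → a k ^ e) (λ k → np * (a k ^ e * fermatQuotient k)))
      (cong (_+_ U) (trans (Σ<-* q np (λ k → a k ^ e * fermatQuotient k)) (ℚ.*-assoc (ι n) (ι p) V)))
    term : ∀ {k} → k ℕ.< q → a k ^ (e ℕ.+ n ℕ.* q) ≡ a k ^ e + np * (a k ^ e * fermatQuotient k) [p^ 2 ]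
    term {k} k<q = ∈-resp (trans (((∀ x y i p f → x * (y - (1ℚ + i * (p * f))) ≡ x * y - (x + i * p * (x * f))) ∋ solve-∀ ℚ-ring)
          (a k ^ e) ((1ℚ + ι p * fermatQuotient k) ^ n) (ι n) (ι p) (fermatQuotient k))
        (cong (_- (a k ^ e + np * (a k ^ e * fermatQuotient k))) (trans (cong (λ y → a k ^ e * y ^ n) (sym (a^q k))) (sym (^-+* (a k) e n)))))
      (^∈ e (ι∈ (suc k)) ·∈ 1+pz-^ n (fermatQuotient∈ k<q))

  -- M = e p, so a^M is (a^p)^e and modulo p² depends only on a modulo p; as e + e q it also fits
  -- `Σa^[e+nq]`.
  M : ℕ
  M = e ℕ.+ e ℕ.* q

  T : ℚ
  T = Σ< q (λ k → a k ^ M)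

  M≡e*p : M ≡ e ℕ.* p
  M≡e*p = sym (ℕ.*-suc e q)

  -- The linear term p · b^(p-1) · p of (b + p)^p already lies in p².
  ^M-periodic : ∀ b → ι (p ℕ.+ b) ^ M ≡ ι b ^ M [p^ 2 ]
  ^M-periodic b = ∈-resp (cong₂ _-_ (^M (ι (p ℕ.+ b))) (^M (ι b))) (^-cong-mod e (^∈ p (ι∈ (p ℕ.+ b))) (^∈ p (ι∈ b)) p-th)
    where
    ^-*ʳ : ∀ x m n → (x ^ m) ^ n ≡ x ^ (n ℕ.* m)
    ^-*ʳ x m zero    = refl
    ^-*ʳ x m (suc n) = trans (cong (x ^ m *_) (^-*ʳ x m n)) (sym (^-+ x m (n ℕ.* m)))
    ^M : ∀ x → (x ^ p) ^ e ≡ x ^ M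
    ^M x = trans (^-*ʳ x p e) (cong (x ^_) (sym M≡e*p))
    p-th : ι (p ℕ.+ b) ^ p ≡ ι b ^ p [p^ 2 ]
    p-th = ∈-resp (trans (((∀ x y z → (x - (y + z)) + z ≡ x - y) ∋ solve-∀ ℚ-ring) ((ι b + ι p * 1ℚ) ^ p) (ι b ^ p) (ι p * ι b ^ q * (ι p * 1ℚ)))
          (cong (λ x → x ^ p - ι b ^ p) (trans (((∀ x y → x + y * 1ℚ ≡ y + x) ∋ solve-∀ ℚ-ring) (ι b) (ι p)) (sym (ι-+ p b)))))
        (+∈ (taylor₁ q (ι∈ b) 1∈)
          (∈-resp (((∀ x y → (x * x) * y ≡ x * y * (x * 1ℚ)) ∋ solve-∀ ℚ-ring) (ι p) (ι b ^ q)) (*∈ p²∈ (^∈ q (ι∈ b)))))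

  -- Modulo p, doubling permutes 1, …, p-1: the doubles are the even numbers below p and, shifted by p, the odd ones.
  doubling : Σ< q (λ k → ι (double (suc k)) ^ M) ≡ T [p^ 2 ]
  doubling = ∈-resp (cong₂ _-_ (sym lhs) (sym (Σ<-double N (λ k → a k ^ M))))
      (Σ-cong-mod {f = λ k → lo k + hi k} {λ k → ι (suc (double k)) ^ M + lo k} N (λ {k} _ → ∈-resp (ring (lo k) (ι (suc (double k)) ^ M) (hi k)) (^M-periodic (suc (double k)))))
    where
    -- For a = k+1 ≤ N the double is 2k+2; for a = N+k+1 it is p + (2k+1), because 2N = p-1.
    lo hi : Seq
    lo k = ι (2 ℕ.+ double k) ^ M
    hi k = ι (p ℕ.+ suc (double k)) ^ M
    lhs : Σ< q (λ k → ι (double (suc k)) ^ M) ≡ Σ< N (λ k → lo k + hi k)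
    lhs = trans (cong (λ n → Σ< n (λ k → ι (double (suc k)) ^ M)) (double≡+ N))
          (trans (Σ<-split N N (λ k → ι (double (suc k)) ^ M))
          (trans (cong (_+_ (Σ< N lo)) (Σ<-cong N (λ k → cong (λ n → ι n ^ M)
                    (trans (cong (suc ∘ suc) (double-+ N k)) (cong suc (sym (ℕ.+-suc q (double k))))))))
                 (sym (Σ<-+ N lo hi))))
    ring : ∀ x y z → z - y ≡ (x + z) - (y + x)
    ring = solve-∀ ℚ-ring

  -- From 2^M T ≡ T the factor 2^M - 1 is to be cancelled. Since M + 2 = (e+1) q, Fermat gives 4 ·
  -- 2^M = 1 - p w, so -4 (2^M - 1) = 3 + p w, a unit as p ≠ 3.
  T∈ : T ∈p^ 2
  T∈ = /unit+p∈ 2 3 (p∤small 7≤p 3 3≤6) (Σ∈ q (λ {k} _ → ^∈ M (ι∈ (suc k)))) w∈ (∈-resp eq (ιℤ∈ (ℤ.- (+ 4)) ·∈ 2^M*T))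
    where
    open ≡-Reasoning
    2^M*T : ι 2 ^ M * T ≡ T [p^ 2 ]
    2^M*T = ∈-resp (cong (_- T) (trans (Σ<-cong q (λ k → trans (cong (_^ M) (ι-double (suc k))) (*-^ (ι 2) (a k) M)))
        (Σ<-* q (ι 2 ^ M) (λ k → a k ^ M)))) doubling
      where
      ι-double : ∀ n → ι (double n) ≡ ι 2 * ι n
      ι-double n = trans (cong ι (double≡+ n)) (trans (ι-+ n n) (((∀ x → x + x ≡ ι 2 * x) ∋ solve-∀ ℚ-ring) (ι n)))
    4*2^M : ι 4 * ι 2 ^ M ≡ (ι 2 ^ q) ^ suc e
    4*2^M = trans (cong (ι 4 *_) (^-+* (ι 2) e e))
      (((∀ x y → ι 4 * (x * y) ≡ ι 2 * (ι 2 * x) * y) ∋ solve-∀ ℚ-ring) (ι 2 ^ e) ((ι 2 ^ q) ^ e))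
    4*2^M≡1 : ι 4 * ι 2 ^ M ≡ 1ℚ [p^ 1 ]
    4*2^M≡1 = ∈-resp (cong₂ _-_ (sym 4*2^M) (1^n (suc e)))
      (^-cong-mod (suc e) (^∈ q (ι∈ 2)) 1∈ (fermat-unit (p∤small 7≤p 2 2≤6)))
    w = (1ℚ - ι 4 * ι 2 ^ M) * inv p
    w∈ : w ∈p^ 0
    w∈ = /p∈ (∈-resp pw (-∈ 4*2^M≡1))
      where
      pw : - (ι 4 * ι 2 ^ M - 1ℚ) ≡ ι p * w
      pw = sym (trans (((∀ x y z → x * ((1ℚ - y) * z) ≡ (x * z) * (1ℚ - y)) ∋ solve-∀ ℚ-ring) (ι p) (ι 4 * ι 2 ^ M) (inv p))
        (trans (cong (_* (1ℚ - ι 4 * ι 2 ^ M)) (ι*inv q)) (((∀ y → 1ℚ * (1ℚ - y) ≡ - (y - 1ℚ)) ∋ solve-∀ ℚ-ring) (ι 4 * ι 2 ^ M))))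
    eq : ιℤ (ℤ.- (+ 4)) * (ι 2 ^ M * T - T) ≡ ι 3 * T + ι p * (w * T)
    eq = begin
      ιℤ (ℤ.- (+ 4)) * (ι 2 ^ M * T - T)              ≡⟨ ((∀ x t → ιℤ (ℤ.- (+ 4)) * (x * t - t) ≡ ι 3 * t + 1ℚ * ((1ℚ - ι 4 * x) * t)) ∋ solve-∀ ℚ-ring) (ι 2 ^ M) T ⟩
      ι 3 * T + 1ℚ * ((1ℚ - ι 4 * ι 2 ^ M) * T)        ≡⟨ cong (λ y → ι 3 * T + y * ((1ℚ - ι 4 * ι 2 ^ M) * T)) (ι*inv q) ⟨
      ι 3 * T + ι p * inv p * ((1ℚ - ι 4 * ι 2 ^ M) * T) ≡⟨ ((∀ p r y t s → s + p * r * (y * t) ≡ s + p * (y * r * t)) ∋ solve-∀ ℚ-ring) (ι p) (inv p) (1ℚ - ι 4 * ι 2 ^ M) T (ι 3 * T) ⟩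
      ι 3 * T + ι p * (w * T)                         ∎

  -- Expanding T in Fermat quotients gives 0 ≡ U + e p V, and e ≡ -3 modulo p.
  U≡3pV : U ≡ ι 3 * (ι p * V) [p^ 2 ]
  U≡3pV = ∈-resp (((∀ t u x v → t + - (t - (u + (x - ι 3) * (x * v))) + - (x * x * v) ≡ u - ι 3 * (x * v)) ∋ solve-∀ ℚ-ring) T U (ι p) V)
    (+∈ (+∈ T∈ (-∈ (∈-resp (cong (λ x → T - (U + x * (ι p * V))) ιe) (Σa^[e+nq] e)))) (-∈ (*∈ p²∈ V∈)))
    where
    ιe : ι e ≡ ι p - ι 3
    ιe = trans (((∀ x → x ≡ ι 3 + x - ι 3) ∋ solve-∀ ℚ-ring) (ι e)) (cong (_- ι 3) (sym (ι-+ 3 e)))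

-- Divided Bernoulli numbers and the logarithm of Wilson's quotient.

module LargePrime (h : ℕ) (p-prime : Prime (7 ℕ.+ double h)) where
  open PowerSums h p-prime
  open Localisation p p-prime
  open Congruences p p-prime
  open OddPrime N p-prime using (wilson; [-1]^q)
  open BernoulliEstimates p p-prime 7≤p using (P; pB; P≡pB[p²]; P≡pB[p⁴])

  -- (n+1)(p-1), written as an even number at least 6 so that `P≡pB[p⁴]` applies directly.
  m : ℕ → ℕ
  m n = 6 ℕ.+ double (h ℕ.+ n ℕ.* N)

  [1+n]q≡m : ∀ n → suc n ℕ.* q ≡ m n
  [1+n]q≡m n = double-* (suc n) N

  ιq : ι q ≡ ι p - 1ℚ
  ιq = ((∀ x → x ≡ 1ℚ + x - 1ℚ) ∋ solve-∀ ℚ-ring) (ι q)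

  P≡Σ : ∀ j → P (suc j) ≡ Σ< q (λ k → a k ^ suc j)
  P≡Σ j = trans (cong (_+ Σ< q (λ k → a k ^ suc j)) (ℚ.*-zeroˡ (0ℚ ^ j))) (ℚ.+-identityˡ (Σ< q (λ k → a k ^ suc j)))

  -- The index is e + n q, where the power sum is U + n p V, and U ≡ 3 p V.
  Bₘ₋₂ : ∀ n → pB (4 ℕ.+ double (h ℕ.+ n ℕ.* N)) ≡ (ι 3 + ι n) * (ι p * V) [p^ 2 ]
  Bₘ₋₂ n = ∈-resp (((∀ b s u i x → - (s - b) + (s - (u + i * x)) + (u - ι 3 * x) ≡ b - (ι 3 + i) * x) ∋ solve-∀ ℚ-ring) b s U (ι n) (ι p * V))
      (+∈ (+∈ (-∈ (∈-resp (cong (_- b) P≡s) (P≡pB[p²] (h ℕ.+ n ℕ.* N)))) (Σa^[e+nq] n)) U≡3pV)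
    where
    b = pB (4 ℕ.+ double (h ℕ.+ n ℕ.* N))
    s = Σ< q (λ k → a k ^ (e ℕ.+ n ℕ.* q))
    P≡s : P (4 ℕ.+ double (h ℕ.+ n ℕ.* N)) ≡ s
    P≡s = trans (P≡Σ (3 ℕ.+ double (h ℕ.+ n ℕ.* N))) (cong (λ j → Σ< q (λ k → a k ^ j))
      (cong (4 ℕ.+_) (trans (double-+ h (n ℕ.* N)) (cong (double h ℕ.+_) (sym (double-* n N))))))

  p[1+n]qBbar : ∀ n → pB (m n) ≡ ι p * ((1ℚ + ι n) * (ι q * Bbar p (suc n))) + ι q
  p[1+n]qBbar n = begin
    pB (m n)                                                       ≡⟨ ((∀ x b → x * b ≡ x * (b + 0ℚ) + (x - 1ℚ) + 1ℚ - x) ∋ solve-∀ ℚ-ring) (ι p) (B (m n)) ⟩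
    ι p * (B (m n) + 0ℚ) + (ι p - 1ℚ) + 1ℚ - ι p                    ≡⟨ cong (λ y → ι p * (B (m n) + 0ℚ) + (ι p - 1ℚ) + y - ι p) (ι*inv q) ⟨
    ι p * (B (m n) + 0ℚ) + (ι p - 1ℚ) + ι p * inv p - ι p           ≡⟨ ((∀ x b r → x * (b + 0ℚ) + (x - 1ℚ) + x * r - x ≡ x * (1ℚ * (b + r - 1ℚ)) + (x - 1ℚ)) ∋ solve-∀ ℚ-ring) (ι p) (B (m n)) (inv p) ⟩
    ι p * (1ℚ * c) + (ι p - 1ℚ)                                    ≡⟨ cong₂ (λ y z → ι p * (y * c) + z) (sym (ι*inv (5 ℕ.+ double (h ℕ.+ n ℕ.* N)))) (sym ιq) ⟩
    ι p * (ι (m n) * inv (m n) * c) + ι q                          ≡⟨ cong (λ y → ι p * y + ι q) (((∀ x y z → x * y * z ≡ x * (z * y)) ∋ solve-∀ ℚ-ring) (ι (m n)) (inv (m n)) c) ⟩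
    ι p * (ι (m n) * (c * inv (m n))) + ι q                        ≡⟨ cong (λ j → ι p * (ι j * ((B j + inv p - 1ℚ) * inv j)) + ι q) ([1+n]q≡m n) ⟨
    ι p * (ι (suc n ℕ.* q) * Bbar p (suc n)) + ι q                 ≡⟨ cong (λ y → ι p * (y * Bbar p (suc n)) + ι q) (ι-* (suc n) q) ⟩
    ι p * (ι (suc n) * ι q * Bbar p (suc n)) + ι q                 ≡⟨ cong (λ y → ι p * y + ι q) (ℚ.*-assoc (ι (suc n)) (ι q) (Bbar p (suc n))) ⟩
    ι p * (ι (suc n) * (ι q * Bbar p (suc n))) + ι q               ∎
    where
    open ≡-Reasoning
    c = B (m n) + inv p - 1ℚ

  -- In `P≡pB[p⁴]` one has m(m-1) ≡ (n+1)(n+2) modulo p and p B_(m-2) ≡ (n+3) p V modulo p².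
  -- Division by p (n+1) leaves the correction p² (n+2)(n+3) V / 6.
  Bbar-congruence : ∀ n {K} → suc n ℕ.≤ 6 → P (m n) ≡ ι q + ι p * ((1ℚ + ι n) * K) →
    ι q * Bbar p (suc n) ≡ K - inv 6 * (ι p * ι p) * ((ι 2 + ι n) * ((ι 3 + ι n) * V)) [p^ 3 ]
  Bbar-congruence n {K} n<6 P≡ = /unit∈ (suc n) (p∤small 7≤p (suc n) n<6) (/p∈ (∈-resp (ring (ι p) (ι n) V K b′ (ι q * b))
      (+∈ (+∈ (-∈ (∈-resp main≡ (P≡pB[p⁴] (h ℕ.+ n ℕ.* N))))
              (-∈ (*∈ p²∈ (((inv∈ 7≤p 6 ℕ.≤-refl) ·∈ (+∈ 1∈ (ι∈ n) ·∈ (p-1∈ ·∈ m₁∈))) ·∈ Bₘ₋₂ n))))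
          -- The cost of replacing m(m-1) by (n+1)(n+2): one more p in a term already carrying p³.
          (-∈ (*∈ (*∈ p²∈ p²∈) ((inv∈ 7≤p 6 ℕ.≤-refl ·∈ (+∈ 1∈ (ι∈ n) ·∈ +∈ (ι∈ 3) (ι∈ n))) ·∈ (V∈ ·∈ +∈ (+∈ 1+n·p∈ (-∈ (ι∈ 2 ·∈ +∈ 1∈ (ι∈ n)))) (-∈ 1∈))))))))
    where
    b = Bbar p (suc n)
    b′ = pB (4 ℕ.+ double (h ℕ.+ n ℕ.* N))
    1+n·p∈ : (1ℚ + ι n) * ι p ∈p^ 0
    1+n·p∈ = ι∈ (suc n) ·∈ ι∈ p
    p-1∈ : ι p - 1ℚ ∈p^ 0
    p-1∈ = +∈ (ι∈ p) (-∈ 1∈)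
    m₁∈ : (1ℚ + ι n) * (ι p - 1ℚ) - 1ℚ ∈p^ 0
    m₁∈ = +∈ (+∈ 1∈ (ι∈ n) ·∈ p-1∈) (-∈ 1∈)
    ιm : ι (m n) ≡ (1ℚ + ι n) * (ι p - 1ℚ)
    ιm = trans (cong ι (sym ([1+n]q≡m n))) (trans (ι-* (suc n) q) (cong (_*_ (1ℚ + ι n)) ιq))
    ιm₁ : ι (5 ℕ.+ double (h ℕ.+ n ℕ.* N)) ≡ (1ℚ + ι n) * (ι p - 1ℚ) - 1ℚ
    ιm₁ = trans (((∀ x → x ≡ 1ℚ + x - 1ℚ) ∋ solve-∀ ℚ-ring) (ι (5 ℕ.+ double (h ℕ.+ n ℕ.* N)))) (cong (_- 1ℚ) ιm)
    F : ℚ → ℚ → ℚ → ℚ → ℚ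
    F s t u v = s - (t + inv 6 * (ι p * ι p) * (u * (v * b′)))
    main≡ : F (P (m n)) (pB (m n)) (ι (m n)) (ι (5 ℕ.+ double (h ℕ.+ n ℕ.* N)))
          ≡ F (ι p - 1ℚ + ι p * ((1ℚ + ι n) * K)) (ι p * ((1ℚ + ι n) * (ι q * b)) + (ι p - 1ℚ)) ((1ℚ + ι n) * (ι p - 1ℚ)) ((1ℚ + ι n) * (ι p - 1ℚ) - 1ℚ)
    main≡ = trans (cong₂ (F (P (m n)) (pB (m n))) ιm ιm₁)
      (cong₂ (λ s t → F s t ((1ℚ + ι n) * (ι p - 1ℚ)) ((1ℚ + ι n) * (ι p - 1ℚ) - 1ℚ))
        (trans P≡ (cong (_+ ι p * ((1ℚ + ι n) * K)) ιq))
        (trans (p[1+n]qBbar n) (cong (_+_ (ι p * ((1ℚ + ι n) * (ι q * b)))) ιq)))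
    ring : ∀ x i v k b′ d →
      - (x - 1ℚ + x * ((1ℚ + i) * k) - (x * ((1ℚ + i) * d) + (x - 1ℚ) + inv 6 * (x * x) * ((1ℚ + i) * (x - 1ℚ) * (((1ℚ + i) * (x - 1ℚ) - 1ℚ) * b′))))
      + - ((x * x) * ((inv 6 * ((1ℚ + i) * ((x - 1ℚ) * ((1ℚ + i) * (x - 1ℚ) - 1ℚ)))) * (b′ - (ι 3 + i) * (x * v))))
      + - ((x * x) * (x * x) * ((inv 6 * ((1ℚ + i) * (ι 3 + i))) * (v * ((1ℚ + i) * x + - (ι 2 * (1ℚ + i)) + - 1ℚ))))
      ≡ x * ((1ℚ + i) * (d - (k - inv 6 * (x * x) * ((ι 2 + i) * ((ι 3 + i) * v)))))
    ring = solve-∀ ℚ-ring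

  Σ-cubic : ∀ c₀ c₁ c₂ c₃ → let f = fermatQuotient in
    Σ< q (λ k → c₀ + c₁ * f k + c₂ * (f k * f k) + c₃ * (f k * f k * f k)) ≡ ι q * c₀ + c₁ * S₁ + c₂ * S₂ + c₃ * S₃
  Σ-cubic c₀ c₁ c₂ c₃ = trans (Σ<-+ q (λ k → c₀ + c₁ * f k + c₂ * (f k * f k)) (scaled c₃ (λ k → f k * f k * f k))) (cong₂ _+_
      (trans (Σ<-+ q (λ k → c₀ + c₁ * f k) (scaled c₂ (λ k → f k * f k))) (cong₂ _+_
        (trans (Σ<-+ q (λ _ → c₀) (scaled c₁ f)) (cong₂ _+_ (Σ<-const q c₀) (Σ<-* q c₁ f)))
        (Σ<-* q c₂ (λ k → f k * f k))))
      (Σ<-* q c₃ (λ k → f k * f k * f k)))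
    where f = fermatQuotient

  P-m : ∀ n → P (m n) ≡ Σ< q (λ k → (1ℚ + ι p * fermatQuotient k) ^ suc n)
  P-m n = trans (P≡Σ (5 ℕ.+ double (h ℕ.+ n ℕ.* N))) (Σ<-cong q (λ k → trans (cong (a k ^_) (sym ([1+n]q≡m n)))
    (trans (^-+* (a k) 0 (suc n)) (trans (ℚ.*-identityˡ ((a k ^ q) ^ suc n)) (cong (_^ suc n) (a^q k))))))

  -- `Kₙ` is (Σ (1 + p q_a)^n - (p-1)) / (n p), an exact value.
  K₁ K₂ K₃ : ℚ
  K₁ = S₁
  K₂ = S₁ + inv 2 * ι p * S₂
  K₃ = S₁ + ι p * S₂ + inv 3 * (ι p * ι p) * S₃

  P₁ : P (m 0) ≡ ι q + ι p * ((1ℚ + ι 0) * K₁)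
  P₁ = trans (P-m 0) (trans (Σ<-cong q (λ k → ((∀ x y → (1ℚ + x * y) * 1ℚ ≡ 1ℚ + x * y + 0ℚ * (y * y) + 0ℚ * (y * y * y)) ∋ solve-∀ ℚ-ring) (ι p) (fermatQuotient k)))
    (trans (Σ-cubic 1ℚ (ι p) 0ℚ 0ℚ) (((∀ q x s t u → q * 1ℚ + x * s + 0ℚ * t + 0ℚ * u ≡ q + x * ((1ℚ + 0ℚ) * s)) ∋ solve-∀ ℚ-ring) (ι q) (ι p) S₁ S₂ S₃)))

  P₂ : P (m 1) ≡ ι q + ι p * ((1ℚ + ι 1) * K₂)
  P₂ = trans (P-m 1) (trans (Σ<-cong q (λ k → ((∀ x y → (1ℚ + x * y) * ((1ℚ + x * y) * 1ℚ) ≡ 1ℚ + (ι 2 * x) * y + (x * x) * (y * y) + 0ℚ * (y * y * y)) ∋ solve-∀ ℚ-ring) (ι p) (fermatQuotient k)))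
    (trans (Σ-cubic 1ℚ (ι 2 * ι p) (ι p * ι p) 0ℚ) (((∀ q x s t u → q * 1ℚ + ι 2 * x * s + x * x * t + 0ℚ * u ≡ q + x * (ι 2 * (s + inv 2 * x * t))) ∋ solve-∀ ℚ-ring) (ι q) (ι p) S₁ S₂ S₃)))

  P₃ : P (m 2) ≡ ι q + ι p * ((1ℚ + ι 2) * K₃)
  P₃ = trans (P-m 2) (trans (Σ<-cong q (λ k → ((∀ x y → (1ℚ + x * y) * ((1ℚ + x * y) * ((1ℚ + x * y) * 1ℚ)) ≡ 1ℚ + (ι 3 * x) * y + (ι 3 * (x * x)) * (y * y) + (x * x * x) * (y * y * y)) ∋ solve-∀ ℚ-ring) (ι p) (fermatQuotient k)))
    (trans (Σ-cubic 1ℚ (ι 3 * ι p) (ι 3 * (ι p * ι p)) (ι p * ι p * ι p)) (((∀ q x s t u → q * 1ℚ + ι 3 * x * s + ι 3 * (x * x) * t + x * x * x * u ≡ q + x * (ι 3 * (s + x * t + inv 3 * (x * x) * u))) ∋ solve-∀ ℚ-ring) (ι q) (ι p) S₁ S₂ S₃)))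

  w b₁ b₂ b₃ β : ℚ
  w  = W p
  b₁ = Bbar p 1
  b₂ = Bbar p 2
  b₃ = Bbar p 3
  β  = Bbar2 p 1

  pw : ι p * w ≡ ι (q !) + 1ℚ
  pw = trans (ι*frac (+ (q ! ℕ.+ 1)) q) (trans (sym (ι≡ιℤ (q ! ℕ.+ 1))) (ι-+ (q !) 1))

  w∈ : w ∈p^ 0
  w∈ = /p∈ (∈-resp (sym pw) wilson)

  -- log (1 - p w) / p, cut after three terms.
  log-w : ℚ
  log-w = - w - inv 2 * ι p * (w * w) - inv 3 * (ι p * ι p) * (w * w * w)

  -- As q is even, (q!)^q = (-q!)^q = (1 - p w)^q, itself a product of q factors 1 + p u with
  -- constant u = -w. So `Π-newton` treats both sides alike, and dividing by p turns p⁴ into p³.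
  log-wilson : logSeries S₁ S₂ S₃ ≡ ι q * log-w [p^ 3 ]
  log-wilson = ∈-resp (cong (_-_ (logSeries S₁ S₂ S₃)) log-const)
      (newton≡⇒log≡ 7≤p {S₁} {S₂} {S₃} {t₁} {t₂} {t₃} S₁∈ S₂∈ S₃∈ t₁∈ t₂∈ t₃∈ (/p∈ p*newton≡))
    where
    open ≡-Reasoning
    u = - w
    u∈ : u ∈p^ 0
    u∈ = -∈ w∈
    t₁ t₂ t₃ Πf Πu : ℚ
    t₁ = Σ< q (λ _ → u)
    t₂ = Σ< q (λ _ → u * u)
    t₃ = Σ< q (λ _ → u * u * u)
    t₁∈ : t₁ ∈p^ 0
    t₁∈ = Σ∈ {f = λ _ → u} q (λ _ → u∈)
    t₂∈ : t₂ ∈p^ 0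
    t₂∈ = Σ∈ {f = λ _ → u * u} q (λ _ → u∈ ·∈ u∈)
    t₃∈ : t₃ ∈p^ 0
    t₃∈ = Σ∈ {f = λ _ → u * u * u} q (λ _ → (u∈ ·∈ u∈) ·∈ u∈)
    Πf = Π< q (λ k → 1ℚ + ι p * fermatQuotient k)
    Πu = Π< q (λ _ → 1ℚ + ι p * u)
    ring : ∀ x s t π → - (π - (ι 6 + x * s)) + (π - (ι 6 + x * t)) ≡ x * (s - t)
    ring = solve-∀ ℚ-ring
    log-const : logSeries (Σ< q (λ _ → u)) (Σ< q (λ _ → u * u)) (Σ< q (λ _ → u * u * u)) ≡ ι q * log-w
    log-const = trans (cong (λ y → logSeries y (Σ< q (λ _ → u * u)) (Σ< q (λ _ → u * u * u))) (Σ<-const q u))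
      (trans (cong₂ (logSeries (ι q * u)) (Σ<-const q (u * u)) (Σ<-const q (u * u * u)))
        (((∀ q x w → q * (- w) - inv 2 * x * (q * ((- w) * (- w))) + inv 3 * (x * x) * (q * ((- w) * (- w) * (- w)))
             ≡ q * (- w - inv 2 * x * (w * w) - inv 3 * (x * x) * (w * w * w))) ∋ solve-∀ ℚ-ring) (ι q) (ι p) w))
    Π≡Π : Πf ≡ Πu
    Π≡Π = begin
      Π< q (λ k → 1ℚ + ι p * fermatQuotient k)    ≡⟨ Π<-cong q a^q ⟨
      Π< q (λ k → a k ^ q)                        ≡⟨ Π<-^ q q a ⟩
      Π< q a ^ q                                  ≡⟨ cong (_^ q) (Π<-factorial q) ⟩
      ι (q !) ^ q                                 ≡⟨ ℚ.*-identityˡ (ι (q !) ^ q) ⟨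
      1ℚ * ι (q !) ^ q                            ≡⟨ cong (_* ι (q !) ^ q) [-1]^q ⟨
      (- 1ℚ) ^ q * ι (q !) ^ q                    ≡⟨ *-^ (- 1ℚ) (ι (q !)) q ⟨
      ((- 1ℚ) * ι (q !)) ^ q                      ≡⟨ cong (_^ q) (((∀ y → (- 1ℚ) * y ≡ 1ℚ - (y + 1ℚ)) ∋ solve-∀ ℚ-ring) (ι (q !))) ⟩
      (1ℚ - (ι (q !) + 1ℚ)) ^ q                   ≡⟨ cong (λ y → (1ℚ - y) ^ q) pw ⟨
      (1ℚ - ι p * w) ^ q                          ≡⟨ cong (_^ q) (((∀ x w → 1ℚ - x * w ≡ 1ℚ + x * (- w)) ∋ solve-∀ ℚ-ring) (ι p) w) ⟩
      (1ℚ + ι p * u) ^ q                          ≡⟨ Π<-const q (1ℚ + ι p * u) ⟨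
      Π< q (λ _ → 1ℚ + ι p * u)                   ∎
    Πf≡ : ι 6 * Πf ≡ ι 6 + ι p * newton S₁ S₂ S₃ [p^ 4 ]
    Πf≡ = Π-newton {fermatQuotient} q fermatQuotient∈
    Πu≡ : ι 6 * Πu ≡ ι 6 + ι p * newton t₁ t₂ t₃ [p^ 4 ]
    Πu≡ = Π-newton {λ _ → u} q (λ _ → u∈)
    p*newton≡ : ι p * (newton S₁ S₂ S₃ - newton t₁ t₂ t₃) ∈p^ 4
    p*newton≡ = ∈-resp (ring (ι p) (newton S₁ S₂ S₃) (newton t₁ t₂ t₃) (ι 6 * Πu))
      (+∈ (-∈ (∈-resp (cong (λ y → ι 6 * y - (ι 6 + ι p * newton S₁ S₂ S₃)) Π≡Π) Πf≡)) Πu≡)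

-- Naming the statement lets it be transported along p ≡ 7 + 2h without unfolding (p ∸ 1)!.
Theorem1p2 : ℕ → Set
Theorem1p2 p = CongMod p 1 (W p) (- Bbar p 1)
    × (p ≥ 5 →
    CongMod p 2 (W p)
    ((- (nℚ 2 * Bbar p 1)) + Bbar p 2
    - frac (+ 1) 2 * nℚ p * Bbar p 1 * Bbar p 1)
    × CongMod p 3 (W p)
    ((- (nℚ 3 * Bbar p 1)) + nℚ 3 * Bbar p 2 - Bbar p 3
    + nℚ p * ((- (frac (+ 3) 2 * Bbar p 1 * Bbar p 1)) + Bbar p 1 * Bbar p 2)
    - nℚ p * nℚ p * (frac (+ 1) 6 * Bbar p 1 * Bbar p 1 * Bbar p 1
    + frac (+ 1) 3 * Bbar2 p 1)))

-- Extrapolation and solution for the Wilson quotient.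

module Conclusion (h : ℕ) (p-prime : Prime (7 ℕ.+ double h)) where
  open PowerSums h p-prime using (N; q; p; e; 7≤p; S₁; S₂; S₃; V; S₁∈; S₂∈; S₃∈; V∈)
  open LargePrime h p-prime
  open Localisation p p-prime
  open Congruences p p-prime
  open OddPrime N p-prime using (p∤<p)

  1≤6 : 1 ℕ.≤ 6
  1≤6 = s≤s z≤n

  p∈₀ : ι p ∈p^ 0
  p∈₀ = ι∈ p

  ½∈ : inv 2 ∈p^ 0
  ½∈ = inv∈ 7≤p 2 2≤6

  ⅓∈ : inv 3 ∈p^ 0
  ⅓∈ = inv∈ 7≤p 3 3≤6

  ⅙∈ : inv 6 ∈p^ 0
  ⅙∈ = inv∈ 7≤p 6 ℕ.≤-refl

  c : ℕ → ℚ
  c n = inv 6 * (ι p * ι p) * ((ι 2 + ι n) * ((ι 3 + ι n) * V))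

  X₁ : ι q * b₁ ≡ K₁ - c 0 [p^ 3 ]
  X₁ = Bbar-congruence 0 {K₁} 1≤6 P₁

  X₂ : ι q * b₂ ≡ K₂ - c 1 [p^ 3 ]
  X₂ = Bbar-congruence 1 {K₂} 2≤6 P₂

  X₃ : ι q * b₃ ≡ K₃ - c 2 [p^ 3 ]
  X₃ = Bbar-congruence 2 {K₃} 3≤6 P₃

  c∈ : ∀ n → c n ∈p^ 2
  c∈ n = ∈-resp (((∀ x y z → y * (x * z) ≡ x * y * z) ∋ solve-∀ ℚ-ring) (inv 6) (ι p * ι p) ((ι 2 + ι n) * ((ι 3 + ι n) * V)))
    (*∈ p²∈ (⅙∈ ·∈ (+∈ (ι∈ 2) (ι∈ n) ·∈ (+∈ (ι∈ 3) (ι∈ n) ·∈ V∈))))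

  p∤q : ¬ p ∣ q
  p∤q = p∤<p (ℕ.n<1+n q)

  /q∈ : ∀ {k x} → ι q * x ∈p^ k → x ∈p^ k
  /q∈ = /unit∈ q p∤q

  b₁∈ : b₁ ∈p^ 0
  b₁∈ = /q∈ (∈-resp (((∀ y k d → y - (k - d) + (k + - d) ≡ y) ∋ solve-∀ ℚ-ring) (ι q * b₁) K₁ (c 0))
    (+∈ (weaken z≤n X₁) (+∈ S₁∈ (-∈ (weaken z≤n (c∈ 0))))))

  -- `Bₘ₋₂ 0` divided by p says e β = B_(p-3) ≡ 3 V, and e ≡ -3.
  β≡ : β + V ∈p^ 1
  β≡ = /unit∈ 3 (p∤small 7≤p 3 3≤6) (∈-resp (((∀ x b v → - ((x - ι 3) * b - ι 3 * v) + x * b ≡ ι 3 * (b + v)) ∋ solve-∀ ℚ-ring) (ι p) β V)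
      (+∈ (-∈ (∈-resp (cong (λ y → y * β - ι 3 * V) ιe) eβ≡3V)) (p*∈ β∈)))
    where
    j : ℕ
    j = 4 ℕ.+ double (h ℕ.+ 0 ℕ.* N)
    j≡e : j ≡ e
    j≡e = cong (λ i → 4 ℕ.+ double i) (ℕ.+-identityʳ h)
    ιe : ι e ≡ ι p - ι 3
    ιe = trans (((∀ x → x ≡ ι 3 + x - ι 3) ∋ solve-∀ ℚ-ring) (ι e)) (cong (_- ι 3) (sym (ι-+ 3 e)))
    eβ : ι e * β ≡ B j
    eβ = begin
      ι e * β                                                 ≡⟨ cong (λ i → ι e * (B (i ℕ.∸ 2) * inv (i ℕ.∸ 2))) ([1+n]q≡m 0) ⟩
      ι e * (B j * inv j)                                     ≡⟨ cong (λ i → ι i * (B j * inv j)) j≡e ⟨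
      ι j * (B j * inv j)                                     ≡⟨ ((∀ x y z → x * (y * z) ≡ (x * z) * y) ∋ solve-∀ ℚ-ring) (ι j) (B j) (inv j) ⟩
      (ι j * inv j) * B j                                     ≡⟨ cong (_* B j) (ι*inv (3 ℕ.+ double (h ℕ.+ 0 ℕ.* N))) ⟩
      1ℚ * B j                                                ≡⟨ ℚ.*-identityˡ (B j) ⟩
      B j                                                     ∎
      where open ≡-Reasoning
    eβ≡3V : ι e * β - ι 3 * V ∈p^ 1
    eβ≡3V = /p∈ (∈-resp (trans (((∀ x b v → x * b - (ι 3 + 0ℚ) * (x * v) ≡ x * (b - ι 3 * v)) ∋ solve-∀ ℚ-ring) (ι p) (B j) V)
      (cong (λ y → ι p * (y - ι 3 * V)) (sym eβ))) (Bₘ₋₂ 0))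
    β∈ : β ∈p^ 0
    β∈ = /unit∈ e (p∤<p (s≤s (ℕ.m≤n+m e 2))) (∈-resp (((∀ x y → x - y + y ≡ x) ∋ solve-∀ ℚ-ring) (ι e * β) (ι 3 * V))
      (+∈ (weaken z≤n eβ≡3V) (ι∈ 3 ·∈ V∈)))

  -- The weights 3, -3, 1 carry a quadratic in n from 1, 2, 3 to 0. On (n+1)(n+2) they give 18 - 36
  -- + 20 = 2, which leaves p² V / 3 to be expressed by β.
  combination₃ : ι 3 * b₁ - ι 3 * b₂ + b₃ + w + inv 2 * ι p * (w * w) + inv 3 * (ι p * ι p) * (w * w * w) + inv 3 * (ι p * ι p) * β ∈p^ 3
  combination₃ = /q∈ (∈-resp eq (+∈ (+∈ (+∈ (+∈ (ι∈ 3 ·∈ X₁) (-∈ (ι∈ 3 ·∈ X₂))) X₃) log-wilson)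
      -- The first summand trades V for -β; the second turns the coefficient -1 of p² β / 3 into q =
      -- p - 1, so that q cancels throughout.
      (+∈ (-∈ (*∈ p²∈ (⅓∈ ·∈ β≡))) (*∈ (*∈ p²∈ p∈) (⅓∈ ·∈ β∈)))))
    where
    β∈ : β ∈p^ 0
    β∈ = ∈-resp (((∀ x y → x + y - y ≡ x) ∋ solve-∀ ℚ-ring) β V) (+∈ (weaken z≤n β≡) (-∈ V∈))
    ring : ∀ x y₁ y₂ y₃ s t u v w b →
      ι 3 * (y₁ - (s - inv 6 * (x * x) * ((ι 2 + ι 0) * ((ι 3 + ι 0) * v))))
      + - (ι 3 * (y₂ - (s + inv 2 * x * t - inv 6 * (x * x) * ((ι 2 + ι 1) * ((ι 3 + ι 1) * v)))))
      + (y₃ - (s + x * t + inv 3 * (x * x) * u - inv 6 * (x * x) * ((ι 2 + ι 2) * ((ι 3 + ι 2) * v))))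
      + (s - inv 2 * x * t + inv 3 * (x * x) * u - w)
      + (- (x * x * (inv 3 * (b + v))) + x * x * x * (inv 3 * b))
      ≡ ι 3 * y₁ - ι 3 * y₂ + y₃ - w + (x - 1ℚ) * (inv 3 * (x * x) * b)
    ring = solve-∀ ℚ-ring
    eq : ι 3 * (ι q * b₁ - (K₁ - c 0)) + - (ι 3 * (ι q * b₂ - (K₂ - c 1))) + (ι q * b₃ - (K₃ - c 2)) + (logSeries S₁ S₂ S₃ - ι q * log-w)
         + (- (ι p * ι p * (inv 3 * (β + V))) + ι p * ι p * ι p * (inv 3 * β))
       ≡ ι q * (ι 3 * b₁ - ι 3 * b₂ + b₃ + w + inv 2 * ι p * (w * w) + inv 3 * (ι p * ι p) * (w * w * w) + inv 3 * (ι p * ι p) * β)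
    eq = trans (ring (ι p) (ι q * b₁) (ι q * b₂) (ι q * b₃) S₁ S₂ S₃ V (ι q * log-w) β)
      (trans (cong (λ y → ι 3 * (ι q * b₁) - ι 3 * (ι q * b₂) + ι q * b₃ - ι q * log-w + y * (inv 3 * (ι p * ι p) * β)) (sym ιq))
        (((∀ q a b c x w d → ι 3 * (q * a) - ι 3 * (q * b) + q * c - q * (- w - inv 2 * x * (w * w) - inv 3 * (x * x) * (w * w * w)) + q * (inv 3 * (x * x) * d)
             ≡ q * (ι 3 * a - ι 3 * b + c + w + inv 2 * x * (w * w) + inv 3 * (x * x) * (w * w * w) + inv 3 * (x * x) * d)) ∋ solve-∀ ℚ-ring)
          (ι q) b₁ b₂ b₃ (ι p) w β))

  -- Modulo p² linear extrapolation with weights 2, -1 suffices; the corrections `c n` and the cubic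
  -- terms lie in p².
  combination₂ : ι 2 * b₁ - b₂ + w + inv 2 * ι p * (w * w) ∈p^ 2
  combination₂ = /q∈ (∈-resp (ring (ι p) (ι q) b₁ b₂ S₁ S₂ S₃ w (c 0) (c 1)) (+∈ (+∈ (+∈ (ι∈ 2 ·∈ lower X₁) (-∈ (lower X₂))) (lower log-wilson))
      (+∈ (+∈ (-∈ (ι∈ 2 ·∈ c∈ 0)) (c∈ 1)) (+∈ (-∈ (*∈ p²∈ (⅓∈ ·∈ S₃∈))) (-∈ (*∈ p²∈ (⅓∈ ·∈ (ι∈ q ·∈ ((w∈ ·∈ w∈) ·∈ w∈)))))))))
    where
    lower : ∀ {x} → x ∈p^ 3 → x ∈p^ 2
    lower = weaken (ℕ.n≤1+n 2)
    ring : ∀ x q a b s t u w c d →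
      ι 2 * (q * a - (s - c)) + - (q * b - (s + inv 2 * x * t - d))
      + (s - inv 2 * x * t + inv 3 * (x * x) * u - q * (- w - inv 2 * x * (w * w) - inv 3 * (x * x) * (w * w * w)))
      + (- (ι 2 * c) + d + (- (x * x * (inv 3 * u)) + - (x * x * (inv 3 * (q * (w * w * w))))))
      ≡ q * (ι 2 * a - b + w + inv 2 * x * (w * w))
    ring = solve-∀ ℚ-ring

  combination₁ : w + b₁ ∈p^ 1
  combination₁ = /q∈ (∈-resp (ring (ι p) (ι q) b₁ S₁ S₂ S₃ w (c 0)) (+∈ (+∈ (weaken 1≤3 X₁) (weaken 1≤3 log-wilson))
      (+∈ (-∈ (weaken (s≤s z≤n) (c∈ 0))) (*∈ p∈ (+∈ (+∈ (½∈ ·∈ S₂∈) (-∈ ((⅓∈ ·∈ p∈₀) ·∈ S₃∈)))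
        (-∈ (ι∈ q ·∈ (+∈ (½∈ ·∈ (w∈ ·∈ w∈)) ((⅓∈ ·∈ p∈₀) ·∈ ((w∈ ·∈ w∈) ·∈ w∈))))))))))
    where
    1≤3 : 1 ℕ.≤ 3
    1≤3 = s≤s z≤n
    ring : ∀ x q a s t u w c →
      (q * a - (s - c)) + (s - inv 2 * x * t + inv 3 * (x * x) * u - q * (- w - inv 2 * x * (w * w) - inv 3 * (x * x) * (w * w * w)))
      + (- c + x * (inv 2 * t + - (inv 3 * x * u) + - (q * (inv 2 * (w * w) + inv 3 * x * (w * w * w)))))
      ≡ q * (w + a)
    ring = solve-∀ ℚ-ring

  theorem-mod-p : CongMod p 1 w (- b₁)
  theorem-mod-p = ∈p^⇒CongMod w (- b₁) (∈-resp (((∀ w b → w + b ≡ w - (- b)) ∋ solve-∀ ℚ-ring) w b₁) combination₁)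

  -- p (w² - b₁²) / 2 factors as p (w + b₁)(w - b₁) / 2 and is in p² by `combination₁`.
  theorem-mod-p² : CongMod p 2 w ((- (nℚ 2 * b₁)) + b₂ - frac (+ 1) 2 * nℚ p * b₁ * b₁)
  theorem-mod-p² = ∈p^⇒CongMod w ((- (nℚ 2 * b₁)) + b₂ - frac (+ 1) 2 * nℚ p * b₁ * b₁) (∈-resp (trans (ring (ι p) w b₁ b₂) (cong (λ y → w - ((- (nℚ 2 * b₁)) + b₂ - frac (+ 1) 2 * y * b₁ * b₁)) (sym (nℚ≡ι p))))
      (+∈ combination₂ (-∈ (*∈ p∈ (*∈ combination₁ (½∈ ·∈ +∈ w∈ (-∈ b₁∈)))))))
    where
    ring : ∀ x w a b → ι 2 * a - b + w + inv 2 * x * (w * w) + - (x * ((w + a) * (inv 2 * (w + - a))))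
      ≡ w - ((- (nℚ 2 * a)) + b - frac (+ 1) 2 * x * a * a)
    ring = solve-∀ ℚ-ring

  -- Here w² is needed modulo p². As (w + b₁)² ≡ 0, it equals -2 b₁ w - b₁², where `combination₂`
  -- replaces w. In the p² terms w ≡ -b₁, and b₁³ collects -1/2 + 1/3 = -1/6.
  theorem-mod-p³ : CongMod p 3 w ((- (nℚ 3 * b₁)) + nℚ 3 * b₂ - b₃
    + nℚ p * ((- (frac (+ 3) 2 * b₁ * b₁)) + b₁ * b₂)
    - nℚ p * nℚ p * (frac (+ 1) 6 * b₁ * b₁ * b₁ + frac (+ 1) 3 * β))
  theorem-mod-p³ = ∈p^⇒CongMod w ((- (nℚ 3 * b₁)) + nℚ 3 * b₂ - b₃
        + nℚ p * ((- (frac (+ 3) 2 * b₁ * b₁)) + b₁ * b₂)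
        - nℚ p * nℚ p * (frac (+ 1) 6 * b₁ * b₁ * b₁ + frac (+ 1) 3 * β)) (∈-resp (trans (ring (ι p) w b₁ b₂ b₃ β) (cong (λ y → w - ((- (nℚ 3 * b₁)) + nℚ 3 * b₂ - b₃
        + y * ((- (frac (+ 3) 2 * b₁ * b₁)) + b₁ * b₂) - y * y * (frac (+ 1) 6 * b₁ * b₁ * b₁ + frac (+ 1) 3 * β))) (sym (nℚ≡ι p))))
      (+∈ combination₃ (*∈ p∈ (+∈ (+∈ (-∈ (½∈ ·∈ *∈ combination₁ combination₁)) (b₁∈ ·∈ combination₂))
        (*∈ p∈ (*∈ combination₁ (+∈ (+∈ (-∈ (⅓∈ ·∈ (w∈ ·∈ w∈))) (-∈ (⅙∈ ·∈ (b₁∈ ·∈ w∈)))) (⅙∈ ·∈ (b₁∈ ·∈ b₁∈)))))))))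
    where
    ring : ∀ x w a b c d →
      ι 3 * a - ι 3 * b + c + w + inv 2 * x * (w * w) + inv 3 * (x * x) * (w * w * w) + inv 3 * (x * x) * d
      + x * (- (inv 2 * ((w + a) * (w + a))) + a * (ι 2 * a - b + w + inv 2 * x * (w * w))
             + x * ((w + a) * (- (inv 3 * (w * w)) + - (inv 6 * (a * w)) + inv 6 * (a * a))))
      ≡ w - ((- (nℚ 3 * a)) + nℚ 3 * b - c + x * ((- (frac (+ 3) 2 * a * a)) + a * b) - x * x * (frac (+ 1) 6 * a * a * a + frac (+ 1) 3 * d))
    ring = solve-∀ ℚ-ring

  conclusion : Theorem1p2 p
  conclusion = theorem-mod-p , λ _ → theorem-mod-p² , theorem-mod-p³

-- Computed primes and the case distinction.

congMod? : ∀ p r x y → Dec (CongMod p r x y)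
congMod? p r x y = (p ℕ.^ r ∣? ℤ.∣ ↥ (x - y) ∣) ×-dec ¬? (p ∣? ↧ₙ (x - y))

parity : ∀ n → (∃ λ h → n ≡ double h) ⊎ (∃ λ h → n ≡ suc (double h))
parity zero    = inj₁ (0 , refl)
parity (suc n) with parity n
... | inj₁ (h , refl) = inj₂ (h , refl)
... | inj₂ (h , refl) = inj₁ (suc h , refl)

2∣double : ∀ h → 2 ∣ double h
2∣double zero    = 2 ℕ∣.∣0
2∣double (suc h) = ℕ∣.∣m∣n⇒∣m+n (ℕ∣.∣-refl {2}) (2∣double h)

data PrimeCase (p : ℕ) : Set where
  p≡2   : p ≡ 2 → PrimeCase p
  p≡3   : p ≡ 3 → PrimeCase p
  p≡5   : p ≡ 5 → PrimeCase p
  p≡7+2h : ∀ h → p ≡ 7 ℕ.+ double h → PrimeCase p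

primeCase : ∀ p → Prime p → PrimeCase p
primeCase 0 pr = contradiction pr (from-no (prime? 0))
primeCase 1 pr = contradiction pr (from-no (prime? 1))
primeCase 2 pr = p≡2 refl
primeCase 3 pr = p≡3 refl
primeCase 4 pr = contradiction pr (from-no (prime? 4))
primeCase 5 pr = p≡5 refl
primeCase 6 pr = contradiction pr (from-no (prime? 6))
primeCase (suc (suc (suc (suc (suc (suc (suc n))))))) pr with parity n
... | inj₁ (h , n≡) = p≡7+2h h (cong (7 ℕ.+_) n≡)
-- Here p is `double (4 + h)`, so 2 would be a divisor other than 1 and p.
... | inj₂ (h , refl) with prime⇒irreducible pr (2∣double (4 ℕ.+ h))
...   | inj₁ ()
...   | inj₂ ()

theorem-2 : Theorem1p2 2
theorem-2 = from-yes (congMod? 2 1 (W 2) (- Bbar 2 1)) , λ { (s≤s (s≤s ())) }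

theorem-3 : Theorem1p2 3
theorem-3 = from-yes (congMod? 3 1 (W 3) (- Bbar 3 1)) , λ { (s≤s (s≤s (s≤s ()))) }

theorem-5 : Theorem1p2 5
theorem-5 = from-yes (congMod? 5 1 (W 5) (- Bbar 5 1)) , λ _ →
    from-yes (congMod? 5 2 (W 5) ((- (nℚ 2 * Bbar p 1)) + Bbar p 2
    - frac (+ 1) 2 * nℚ p * Bbar p 1 * Bbar p 1))
  , from-yes (congMod? 5 3 (W 5) ((- (nℚ 3 * Bbar p 1)) + nℚ 3 * Bbar p 2 - Bbar p 3
    + nℚ p * ((- (frac (+ 3) 2 * Bbar p 1 * Bbar p 1)) + Bbar p 1 * Bbar p 2)
    - nℚ p * nℚ p * (frac (+ 1) 6 * Bbar p 1 * Bbar p 1 * Bbar p 1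
    + frac (+ 1) 3 * Bbar2 p 1)))
  where
  p : ℕ
  p = 5

theorem-large : ∀ p → Prime p → ∀ h → p ≡ 7 ℕ.+ double h → Theorem1p2 p
theorem-large p pr h p≡ = subst Theorem1p2 (sym p≡′) (Conclusion.conclusion h pr′)
  where
  pr′ : Prime (7 ℕ.+ double h)
  pr′ = subst Prime p≡ pr
  p≡′ : p ≡ PowerSums.p h pr′
  p≡′ = p≡

theorem1p2 : (p : ℕ) → Prime p →
    CongMod p 1 (W p) (- Bbar p 1)
    × (p ≥ 5 →
    CongMod p 2 (W p)
    ((- (nℚ 2 * Bbar p 1)) + Bbar p 2
    - frac (+ 1) 2 * nℚ p * Bbar p 1 * Bbar p 1)
    × CongMod p 3 (W p)
    ((- (nℚ 3 * Bbar p 1)) + nℚ 3 * Bbar p 2 - Bbar p 3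
    + nℚ p * ((- (frac (+ 3) 2 * Bbar p 1 * Bbar p 1)) + Bbar p 1 * Bbar p 2)
    - nℚ p * nℚ p * (frac (+ 1) 6 * Bbar p 1 * Bbar p 1 * Bbar p 1
    + frac (+ 1) 3 * Bbar2 p 1)))
theorem1p2 p pr = by-case (primeCase p pr)
  where
  by-case : PrimeCase p → Theorem1p2 p
  by-case (p≡2 eq)      = subst Theorem1p2 (sym eq) theorem-2
  by-case (p≡3 eq)      = subst Theorem1p2 (sym eq) theorem-3
  by-case (p≡5 eq)      = subst Theorem1p2 (sym eq) theorem-5
  by-case (p≡7+2h h eq) = theorem-large p pr h eq
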